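{- Let $n\ge 4$ and let $G$ be an optimal digraph on $n$ vertices. Then $\beta_G \leq \alpha_G$. Furthermore, either $\alpha_G = \beta_G$ or $\alpha_G = \beta_G + 1$.
   Context: Digraphs are finite and simple (no loops, no multiple edges); $2$-free means no distinct $u,v$ with both $uv,vu\in E(G)$. A circular interval digraph is a digraph whose vertices are arranged in a (fixed) circle such that for all distinct $u,v,w$ in clockwise order, $uw\in E(G)$ implies $uv,vw\in E(G)$. For distinct vertices $u,v$ let $d(u,v)=1+|\{w: u,w,v \text{ distinct, in clockwise order}\}|$; this is the length of the ordered pair $uv$. A non-edge is an ordered pair $uv$ of distinct vertices with $uv\notin E(G)$ and $vu\notin E(G)$; its length is $d(u,v)$. $\alpha_G$ is the least length of a non-edge ($\infty$ if there is none) and $\beta_G$ the greatest length of an edge ($0$ if there is none). $\tilde{P}_3(G)$ is the number of ordered triples $(u,w,v)$ of distinct vertices with $uw,wv\in E(G)$ and neither $uv$ nor $vu$ in $E(G)$. $\xi(G)$ is the number of pairs $(uv,wx)$ where $uv\in E(G)$, $wx$ is a non-edge and $d(u,v)>d(w,x)$. For fixed $n\ge 4$, a digraph $G$ is optimal if it is a $2$-free circular interval digraph on $n$ vertices which, among all $2$-free circular interval digraphs on $n$ vertices, maximizes $\tilde{P}_3$, and subject to this minimizes $\xi$. -}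

module Defs where

open import Data.Nat using (ℕ; zero; suc; _+_; _<ᵇ_; _≤_; _⊔_; _⊓_)
open import Data.Bool using (Bool; true; false; _∧_; _∨_; not; if_then_else_; T)
open import Data.Fin using (Fin; toℕ)
open import Data.Fin.Properties using (_≟_)
open import Data.List using (List; []; _∷_; allFin; map; foldr; concatMap)
open import Data.Nat.ListAction using (sum)
open import Data.Unit using (⊤)
open import Data.Maybe using (Maybe; just; nothing)
open import Data.Product using (_×_; _,_)
open import Relation.Nullary using (¬_)
open import Relation.Nullary.Decidable using (⌊_⌋)
open import Relation.Binary.PropositionalEquality using (_≡_)

-- A digraph on vertex set Fin n, given by a Boolean edge relation, without loops.
-- The circle is fixed: vertices 0,1,...,n-1 placed in clockwise order.
record Digraph (n : ℕ) : Set where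
  field
    edge     : Fin n → Fin n → Bool
    loopless : ∀ u → edge u u ≡ false
open Digraph public

_≢ᵇ_ : ∀ {n} → Fin n → Fin n → Bool
u ≢ᵇ v = not ⌊ u ≟ v ⌋

-- u, w, v are distinct and in clockwise order (i.e. a cyclic rotation of an
-- increasing triple of positions)
cwᵇ : ∀ {n} → Fin n → Fin n → Fin n → Bool
cwᵇ u w v =
  let a = toℕ u ; b = toℕ w ; c = toℕ v in
  ((a <ᵇ b) ∧ (b <ᵇ c)) ∨ ((b <ᵇ c) ∧ (c <ᵇ a)) ∨ ((c <ᵇ a) ∧ (a <ᵇ b))

Clockwise : ∀ {n} → Fin n → Fin n → Fin n → Set
Clockwise u w v = T (cwᵇ u w v)

𝟙 : Bool → ℕ
𝟙 true  = 1
𝟙 false = 0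

Σv : ∀ {n} → (Fin n → ℕ) → ℕ
Σv {n} f = sum (map f (allFin n))

d : ∀ {n} → Fin n → Fin n → ℕ
d u v = suc (Σv (λ w → 𝟙 (cwᵇ u w v)))

TwoFree : ∀ {n} → Digraph n → Set
TwoFree G = ∀ u v → ¬ (edge G u v ≡ true × edge G v u ≡ true)

CircularInterval : ∀ {n} → Digraph n → Set
CircularInterval G =
  ∀ u v w → Clockwise u v w → edge G u w ≡ true →
  edge G u v ≡ true × edge G v w ≡ true

nonEdgeᵇ : ∀ {n} → Digraph n → Fin n → Fin n → Bool
nonEdgeᵇ G u v = (u ≢ᵇ v) ∧ not (edge G u v) ∧ not (edge G v u)

P̃₃ : ∀ {n} → Digraph n → ℕ
P̃₃ G = Σv λ u → Σv λ w → Σv λ v →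
  𝟙 ((u ≢ᵇ w) ∧ (w ≢ᵇ v) ∧ (u ≢ᵇ v) ∧ edge G u w ∧ edge G w v
      ∧ not (edge G u v) ∧ not (edge G v u))

ξ : ∀ {n} → Digraph n → ℕ
ξ G = Σv λ u → Σv λ v → Σv λ w → Σv λ x →
  𝟙 (edge G u v ∧ nonEdgeᵇ G w x ∧ (d w x <ᵇ d u v))

pairs : ∀ {n} → List (Fin n × Fin n)
pairs {n} = concatMap (λ u → map (λ v → (u , v)) (allFin n)) (allFin n)

minℕ∞ : Maybe ℕ → Maybe ℕ → Maybe ℕ
minℕ∞ nothing  m        = m
minℕ∞ (just a) nothing  = just a
minℕ∞ (just a) (just b) = just (a ⊓ b)

-- α_G: least length of a non-edge (nothing = ∞ if there is none)
α : ∀ {n} → Digraph n → Maybe ℕ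
α G = foldr (λ { (u , v) acc →
          if nonEdgeᵇ G u v then minℕ∞ (just (d u v)) acc else acc })
        nothing pairs

-- β_G: greatest length of an edge (0 if there is none)
β : ∀ {n} → Digraph n → ℕ
β G = foldr (λ { (u , v) acc →
          if edge G u v then d u v ⊔ acc else acc })
        0 pairs

Admissible : ∀ {n} → Digraph n → Set
Admissible G = TwoFree G × CircularInterval G

Optimal : ∀ n → Digraph n → Set
Optimal n G =
  Admissible G ×
  (∀ (H : Digraph n) → Admissible H → P̃₃ H ≤ P̃₃ G) ×
  (∀ (H : Digraph n) → Admissible H → P̃₃ H ≡ P̃₃ G → ξ G ≤ ξ H)

_≤∞_ : ℕ → Maybe ℕ → Set
m ≤∞ nothing = ⊤
m ≤∞ just a  = m ≤ a

{-# OPTIONS --safe #-}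
module Submission where

-- Counting induced paths over clockwise triples expresses P̃₃ as a cubic polynomial in the adjacency
-- indicators, so the effect of any set of edge changes can be read off its expansion.  Deleting longest
-- edges and inserting shortest non-edges keeps a digraph in the class when α < β, and it lowers ξ.
-- Assume α < β.  Deleting one longest edge uv, inserting one shortest non-edge xy, and exchanging two
-- such pairs that share a vertex and close up to a triangle must all fail to improve an optimal
-- digraph.  These inequalities involve only n, α, β and the degrees at the ends of the pairs, and
-- since degrees lie between α - 1 and β they force every degree bound to be attained:
-- the head of each shortest non-edge is the tail of a longest edge and vice versa.  Exchanging all
-- longest edges for all shortest non-edges at once then preserves P̃₃ and decreases ξ, a contradiction.
-- For α ≤ β + 1, the nearest non-out-neighbour of x, for a shortest non-edge xy, lies at distance at
-- most β + 1, and 2α ≤ n excludes an edge from it back to x.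

open import Defs
open import Data.Bool using (Bool; true; false; _∧_; _∨_; not; if_then_else_)
import Data.Bool.Properties as Bool
open import Data.Empty using (⊥; ⊥-elim)
open import Data.Fin using (Fin; zero; suc; toℕ; punchIn)
open import Data.Fin.Properties using (_≟_; any?; punchInᵢ≢i; toℕ-injective)
open import Data.Integer using (ℤ; +_; -_; _+_; _-_; _*_; 0ℤ; 1ℤ; +≤+)
  renaming (_≤_ to _≤ᶻ_)
import Data.Integer.Properties as ℤ
open import Data.Integer.Tactic.RingSolver using (solve-∀)
open import Data.List using (List; []; _∷_; map; allFin; tabulate; foldr)
open import Data.List.Membership.Propositional using (_∈_)
open import Data.List.Membership.Propositional.Properties using (∈-allFin; ∈-map⁺; ∈-concatMap⁺)
open import Data.List.Properties using (map-tabulate; map-cong)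
import Data.List.Relation.Unary.Any as Any
open import Data.List.Relation.Unary.Any using (here; there)
open import Data.Maybe using (Maybe; just; nothing)
open import Data.Nat using (ℕ; zero; suc; _≤_; _<_; s≤s; z≤n; _<?_; _<ᵇ_; _⊔_; _⊓_)
import Data.Nat as ℕ
import Data.Nat.Properties as ℕ
open import Data.Nat.Induction using (<-wellFounded)
open import Data.Nat.ListAction using () renaming (sum to sumᴸ)
import Data.Product as Product
open import Data.Product using (∃; _×_; _,_; proj₁; proj₂)
import Data.Sum as Sum
open import Data.Sum using (_⊎_; inj₁; inj₂)
open import Function using (_∘_; Equivalence)
open import Induction.WellFounded using (Acc; acc)
open import Relation.Binary.PropositionalEquality
open import Relation.Binary.Definitions using (tri<; tri≈; tri>)
open import Relation.Nullary using (¬_; Dec; yes; no; ofʸ)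
open import Relation.Nullary.Decidable using (⌊_⌋; _×-dec_; ¬?)
open import Algebra.Properties.Semiring.Sum ℤ.+-*-semiring
  using (sum; sum-cong-≗; sum-remove; sum-replicate-zero; ∑-distrib-+; ∑-comm; *-distribˡ-sum)

-- For a longest edge uv and a shortest non-edge xy put P = outdeg v + indeg u and P' = outdeg y +
-- indeg x. Counting gives gain(uv) - gain(xy) ≤ D with D = 2(P' - P) - 4(β - α), and the degree
-- bounds give D ≤ 4. Deletion and insertion alone yield D ≥ 1, hence D ≥ 2 because D is even; this
-- still allows one degree to miss its bound by one. Two exchanged pairs that meet at a vertex and
-- are closed up by an edge add 2 to the effect on P̃₃, so such an exchange yields D ≥ 3, hence D =
-- 4. Even then a single exchange may lose up to 2, so no single one is contradictory. But tightness
-- makes shortest non-edges and longest edges alternate along closed walks. When all are exchanged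
-- together, every changed pair meets another one at both ends, and the two junctions per exchange
-- contribute 4, which makes up for the whole possible deficit D.

private
  variable
    n : ℕ

-- Truth values and their integer indicators

⟦_⟧ : Bool → ℤ
⟦ b ⟧ = + 𝟙 b

_≡ᶠ_ : Fin n → Fin n → Bool
u ≡ᶠ v = ⌊ u ≟ v ⌋

≡ᶠ-refl : (u : Fin n) → (u ≡ᶠ u) ≡ true
≡ᶠ-refl u with u ≟ u
... | yes _  = refl
... | no u≢u = ⊥-elim (u≢u refl)

≢⇒≡ᶠ-false : {u v : Fin n} → u ≢ v → (u ≡ᶠ v) ≡ false
≢⇒≡ᶠ-false {u = u} {v} u≢v with u ≟ v
... | yes u≡v = ⊥-elim (u≢v u≡v)
... | no _    = refl

≡ᶠ-true⇒≡ : {u v : Fin n} → (u ≡ᶠ v) ≡ true → u ≡ v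
≡ᶠ-true⇒≡ {u = u} {v} _ with yes u≡v ← u ≟ v = u≡v

true≢false : {b : Bool} → b ≡ true → b ≡ false → ⊥
true≢false refl ()

¬true⇒false : {b : Bool} → ¬ (b ≡ true) → b ≡ false
¬true⇒false {false} _ = refl
¬true⇒false {true}  h = ⊥-elim (h refl)

true⊎false : (b : Bool) → b ≡ true ⊎ b ≡ false
true⊎false true  = inj₁ refl
true⊎false false = inj₂ refl

∧-true⁻ : {a b : Bool} → a ∧ b ≡ true → a ≡ true × b ≡ true
∧-true⁻ {true} {true} _ = refl , refl

≡true⇔⇒≡ : {a b : Bool} → (a ≡ true → b ≡ true) → (b ≡ true → a ≡ true) → a ≡ b
≡true⇔⇒≡ {true}          f _ = sym (f refl)
≡true⇔⇒≡ {false} {true}  _ g = g refl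
≡true⇔⇒≡ {false} {false} _ _ = refl

𝟙-mono : {a b : Bool} → (a ≡ true → b ≡ true) → 𝟙 a ≤ 𝟙 b
𝟙-mono {false}        _ = z≤n
𝟙-mono {true} {true}  _ = s≤s z≤n
𝟙-mono {true} {false} f with () ← f refl

-- Sums over vertices

module _ {A : Set} {f g : A → ℕ} (f≤g : ∀ x → f x ≤ g x) where

  sum-map-mono-≤ : ∀ xs → sumᴸ (map f xs) ≤ sumᴸ (map g xs)
  sum-map-mono-≤ []       = z≤n
  sum-map-mono-≤ (x ∷ xs) = ℕ.+-mono-≤ (f≤g x) (sum-map-mono-≤ xs)

  sum-map-mono-< : ∀ {x xs} → x ∈ xs → f x < g x → sumᴸ (map f xs) < sumᴸ (map g xs)
  sum-map-mono-< (here {xs = xs} refl) fx<gx = ℕ.+-mono-<-≤ fx<gx (sum-map-mono-≤ xs)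
  sum-map-mono-< (there {x = y} x∈xs)  fx<gx = ℕ.+-mono-≤-< (f≤g y) (sum-map-mono-< x∈xs fx<gx)

Σv-mono-≤ : {f g : Fin n → ℕ} → (∀ u → f u ≤ g u) → Σv f ≤ Σv g
Σv-mono-≤ f≤g = sum-map-mono-≤ f≤g (allFin _)

Σv-mono-< : {f g : Fin n → ℕ} → (∀ u → f u ≤ g u) → ∀ u → f u < g u → Σv f < Σv g
Σv-mono-< f≤g u = sum-map-mono-< f≤g (∈-allFin u)

Σv-cong : {f g : Fin n → ℕ} → (∀ u → f u ≡ g u) → Σv f ≡ Σv g
Σv-cong f≗g = cong sumᴸ (map-cong f≗g (allFin _))

Σv-zero : {f : Fin n → ℕ} → (∀ u → f u ≡ 0) → Σv f ≡ 0
Σv-zero {n = n} {f} f≗0 = go (allFin n)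
  where
  go : ∀ xs → sumᴸ (map f xs) ≡ 0
  go []       = refl
  go (x ∷ xs) = cong₂ ℕ._+_ (f≗0 x) (go xs)

Σv-sum : (f : Fin n → ℕ) → + Σv f ≡ sum (λ u → + f u)
Σv-sum f = trans (cong (λ xs → + sumᴸ xs) (map-tabulate (λ u → u) f)) (go f)
  where
  go : ∀ {m} (g : Fin m → ℕ) → + sumᴸ (tabulate g) ≡ sum (λ u → + g u)
  go {ℕ.zero}  g = refl
  go {ℕ.suc m} g = cong (λ z → + g zero + z) (go (g ∘ suc))

sum-zero : {f : Fin n → ℤ} → (∀ u → f u ≡ 0ℤ) → sum f ≡ 0ℤ
sum-zero {n = n} f≗0 = trans (sum-cong-≗ f≗0) (sum-replicate-zero n)

sum-single : {f : Fin n → ℤ} (v : Fin n) → (∀ u → u ≢ v → f u ≡ 0ℤ) → sum f ≡ f v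
sum-single {ℕ.suc _} {f} v f≗0 = begin
  sum f                             ≡⟨ sum-remove {i = v} f ⟩
  f v + sum (λ u → f (punchIn v u)) ≡⟨ cong (λ z → f v + z) (sum-zero λ u → f≗0 _ (punchInᵢ≢i v u)) ⟩
  f v + 0ℤ                          ≡⟨ ℤ.+-identityʳ _ ⟩
  f v                               ∎
  where open ≡-Reasoning

sum-δ : (f : Fin n → ℤ) (v : Fin n) → sum (λ u → ⟦ u ≡ᶠ v ⟧ * f u) ≡ f v
sum-δ f v = trans (sum-single v (λ u u≢v → cong (λ b → ⟦ b ⟧ * f u) (≢⇒≡ᶠ-false u≢v)))
  (trans (cong (λ b → ⟦ b ⟧ * f v) (≡ᶠ-refl v)) (ℤ.*-identityˡ (f v)))

sum-≡ᶠ : (v : Fin n) → sum (λ u → ⟦ u ≡ᶠ v ⟧) ≡ 1ℤ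
sum-≡ᶠ v = trans (sum-single v λ u u≢v → cong ⟦_⟧ (≢⇒≡ᶠ-false u≢v)) (cong ⟦_⟧ (≡ᶠ-refl v))

sum-one : sum {n} (λ _ → 1ℤ) ≡ + n
sum-one {n = ℕ.zero}  = refl
sum-one {n = ℕ.suc n} = cong (λ z → 1ℤ + z) (sum-one {n})

sum-mono : {f g : Fin n → ℤ} → (∀ u → f u ≤ᶻ g u) → sum f ≤ᶻ sum g
sum-mono {n = ℕ.zero}  f≤g = ℤ.≤-refl
sum-mono {n = ℕ.suc _} f≤g = ℤ.+-mono-≤ (f≤g zero) (sum-mono (f≤g ∘ suc))

sum-nonneg : {f : Fin n → ℤ} → (∀ u → 0ℤ ≤ᶻ f u) → 0ℤ ≤ᶻ sum f
sum-nonneg {n} {f} 0≤f = subst (_≤ᶻ sum f) (sum-replicate-zero n) (sum-mono 0≤f)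

sum-scale : (k : ℤ) (f : Fin n → ℤ) → sum (λ u → k * f u) ≡ k * sum f
sum-scale k f = sym (*-distribˡ-sum k f)

sum-sub : (f g : Fin n → ℤ) → sum (λ u → f u - g u) ≡ sum f - sum g
sum-sub f g = begin
  sum (λ u → f u - g u)              ≡⟨ ∑-distrib-+ f (λ u → - g u) ⟩
  sum f + sum (λ u → - g u)          ≡⟨ cong (λ z → sum f + z) (sum-cong-≗ λ u → sym (ℤ.-1*i≡-i (g u))) ⟩
  sum f + sum (λ u → - 1ℤ * g u)     ≡⟨ cong (λ z → sum f + z) (sum-scale (- 1ℤ) g) ⟩
  sum f + - 1ℤ * sum g               ≡⟨ cong (λ z → sum f + z) (ℤ.-1*i≡-i (sum g)) ⟩
  sum f - sum g                      ∎
  where open ≡-Reasoning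

argmin : {P : Fin n → Set} → (∀ u → Dec (P u)) → (f : Fin n → ℕ) →
         ∃ P → ∃ λ u → P u × (∀ v → P v → f u ≤ f v)
argmin {n} {P} P? f (u , Pu) = go u Pu (<-wellFounded (f u))
  where
  go : ∀ u → P u → Acc _<_ (f u) → ∃ λ u → P u × (∀ v → P v → f u ≤ f v)
  go u Pu (acc rs) with any? (λ v → P? v ×-dec (f v <? f u))
  ... | yes (v , Pv , fv<fu) = go v Pv (rs fv<fu)
  ... | no ∄smaller = u , Pu , λ v Pv → ℕ.≮⇒≥ λ fv<fu → ∄smaller (v , Pv , fv<fu)

-- Cyclic orders: c u w v says that u, w, v are distinct and in clockwise order

record IsCyclicOrder {n} (c : Fin n → Fin n → Fin n → Bool) : Set where
  field
    rotate : ∀ {u w v} → c u w v ≡ true → c w v u ≡ true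
    asym   : ∀ {u w v} → c u w v ≡ true → c v w u ≡ true → ⊥
    total  : ∀ {u w v} → u ≢ w → w ≢ v → u ≢ v → c u w v ≡ true ⊎ c v w u ≡ true
    chain  : ∀ {u w v x} → c u w v ≡ true → c u v x ≡ true → c u w x ≡ true

-- Reversing the circle exchanges heads and tails, so facts about in-neighbours come from those
-- about out-neighbours.
reverse : {c : Fin n → Fin n → Fin n → Bool} →
          IsCyclicOrder c → IsCyclicOrder (λ u w v → c v w u)
reverse isC = record
  { rotate = rotate ∘ rotate
  ; asym   = asym
  ; total  = λ u≢w w≢v u≢v → total (w≢v ∘ sym) (u≢w ∘ sym) (u≢v ∘ sym)
  ; chain  = λ vwu xvu → rotate (chain (rotate (rotate xvu)) (rotate (rotate vwu)))
  }
  where open IsCyclicOrder isC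

module CyclicOrder {n} {c : Fin n → Fin n → Fin n → Bool} (isC : IsCyclicOrder c) where
  open IsCyclicOrder isC public

  dist : Fin n → Fin n → ℕ
  dist u v = ℕ.suc (Σv λ w → 𝟙 (c u w v))

  distinct₁₃ : ∀ {u w v} → c u w v ≡ true → u ≢ v
  distinct₁₃ uwu refl = asym uwu uwu

  distinct₁₂ : ∀ {u w v} → c u w v ≡ true → u ≢ w
  distinct₁₂ uwv u≡w = distinct₁₃ (rotate uwv) (sym u≡w)

  distinct₂₃ : ∀ {u w v} → c u w v ≡ true → w ≢ v
  distinct₂₃ uwv w≡v = distinct₁₃ (rotate (rotate uwv)) (sym w≡v)

  c-rotate : ∀ u w v → c u w v ≡ c w v u
  c-rotate u w v = ≡true⇔⇒≡ rotate (rotate ∘ rotate)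

  c-asym : ∀ {u w v} → c u w v ≡ true → c v w u ≡ false
  c-asym uwv = ¬true⇒false (asym uwv)

  c₁₁ : ∀ {u v} → c u u v ≡ false
  c₁₁ = ¬true⇒false λ h → distinct₁₂ h refl

  c₂₂ : ∀ {u v} → c u v v ≡ false
  c₂₂ = ¬true⇒false λ h → distinct₂₃ h refl

  -- The four events x ∈ (u , v), x ∈ (v , u), x = u, x = v partition the circle.
  dist-flip : ∀ {u v} → u ≢ v → dist u v ℕ.+ dist v u ≡ n
  dist-flip {u} {v} u≢v = ℤ.+-injective (begin
    + dist u v + + dist v u
      ≡⟨ cong₂ (λ a b → (1ℤ + a) + (1ℤ + b)) (Σv-sum {n} _) (Σv-sum {n} _) ⟩
    (1ℤ + sum (λ x → ⟦ c u x v ⟧)) + (1ℤ + sum (λ x → ⟦ c v x u ⟧))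
      ≡⟨ cong₂ (λ a b → (a + sum (λ x → ⟦ c u x v ⟧)) + (b + sum (λ x → ⟦ c v x u ⟧)))
           (sym (sum-≡ᶠ u)) (sym (sum-≡ᶠ v)) ⟩
    (sum (λ x → ⟦ x ≡ᶠ u ⟧) + sum (λ x → ⟦ c u x v ⟧))
      + (sum (λ x → ⟦ x ≡ᶠ v ⟧) + sum (λ x → ⟦ c v x u ⟧))
      ≡⟨ cong₂ _+_ (sym (∑-distrib-+ {n} _ _)) (sym (∑-distrib-+ {n} _ _)) ⟩
    sum (λ x → ⟦ x ≡ᶠ u ⟧ + ⟦ c u x v ⟧) + sum (λ x → ⟦ x ≡ᶠ v ⟧ + ⟦ c v x u ⟧)
      ≡⟨ sym (∑-distrib-+ {n} _ _) ⟩
    sum (λ x → (⟦ x ≡ᶠ u ⟧ + ⟦ c u x v ⟧) + (⟦ x ≡ᶠ v ⟧ + ⟦ c v x u ⟧))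
      ≡⟨ sum-cong-≗ partition ⟩
    sum {n} (λ _ → 1ℤ)
      ≡⟨ sum-one ⟩
    + n ∎)
    where
    open ≡-Reasoning
    partition : ∀ x → (⟦ x ≡ᶠ u ⟧ + ⟦ c u x v ⟧) + (⟦ x ≡ᶠ v ⟧ + ⟦ c v x u ⟧) ≡ 1ℤ
    partition x with x ≟ u | x ≟ v
    ... | yes refl | yes refl = ⊥-elim (u≢v refl)
    ... | yes refl | no _ rewrite c₁₁ {u} {v} | c₂₂ {v} {u} = refl
    ... | no _ | yes refl rewrite c₁₁ {v} {u} | c₂₂ {u} {v} = refl
    ... | no x≢u | no x≢v with total (x≢u ∘ sym) x≢v u≢v
    ... | inj₁ uxv rewrite uxv | c-asym uxv = refl
    ... | inj₂ vxu rewrite vxu | c-asym vxu = refl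

  dist-mono-< : ∀ {u w v} → c u w v ≡ true → dist u w < dist u v
  dist-mono-< {u} {w} {v} uwv = s≤s (Σv-mono-< (λ x → 𝟙-mono λ uxw → chain uxw uwv) w w-new)
    where
    w-new : 𝟙 (c u w w) < 𝟙 (c u w v)
    w-new rewrite c₂₂ {u} {w} | uwv = s≤s z≤n

-- Neighbourhoods as arcs of the circle

module OutNeighbours {n} {c : Fin n → Fin n → Fin n → Bool} (isC : IsCyclicOrder c)
  (e : Fin n → Fin n → Bool) (irrefl : ∀ u → e u u ≡ false)
  (convex : ∀ {u v w} → c u v w ≡ true → e u w ≡ true → e u v ≡ true) where

  open CyclicOrder isC

  private module Rev = CyclicOrder (reverse isC)

  outdeg : Fin n → ℕ
  outdeg u = Σv λ w → 𝟙 (e u w)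

  e⇒≢ : ∀ {u v} → e u v ≡ true → u ≢ v
  e⇒≢ uv refl = true≢false uv (irrefl _)

  -- By convexity the out-neighbours of `u` fill the arc up to the farthest one, so their number is
  -- its distance. The farthest one is found by minimising the remaining distance round to `u`.
  last-out : ∀ {u x} → e u x ≡ true →
             ∃ λ w → e u w ≡ true × outdeg u ≡ dist u w
  last-out {u} {x} ux with argmin (λ w → e u w Bool.≟ true) (λ w → dist w u) (x , ux)
  ... | w , uw , w-last = w , uw , ℤ.+-injective (begin
    + outdeg u
      ≡⟨ Σv-sum {n} _ ⟩
    sum (λ y → ⟦ e u y ⟧)
      ≡⟨ sum-cong-≗ split ⟩
    sum (λ y → ⟦ y ≡ᶠ w ⟧ + ⟦ c u y w ⟧)
      ≡⟨ ∑-distrib-+ {n} _ _ ⟩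
    sum (λ y → ⟦ y ≡ᶠ w ⟧) + sum (λ y → ⟦ c u y w ⟧)
      ≡⟨ cong₂ _+_ (sum-≡ᶠ w) (sym (Σv-sum {n} _)) ⟩
    + dist u w ∎)
    where
    open ≡-Reasoning
    split : ∀ y → ⟦ e u y ⟧ ≡ ⟦ y ≡ᶠ w ⟧ + ⟦ c u y w ⟧
    split y with y ≟ w | true⊎false (e u y)
    ... | yes refl | _ rewrite uw | c₂₂ {u} {w} = refl
    ... | no _ | inj₂ ¬uy rewrite ¬uy | ¬true⇒false {c u y w} (λ uyw → true≢false (convex uyw uw) ¬uy) = refl
    ... | no y≢w | inj₁ uy with total (e⇒≢ uy) y≢w (e⇒≢ uw)
    ... | inj₁ uyw rewrite uy | uyw = refl
    ... | inj₂ wyu = ⊥-elim (ℕ.<⇒≱ (Rev.dist-mono-< wyu) (w-last y uy))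

  first-non-out : ∀ {u x} → u ≢ x → e u x ≡ false →
                  ∃ λ m → u ≢ m × e u m ≡ false × ℕ.suc (outdeg u) ≡ dist u m
  first-non-out {u} {x} u≢x ¬ux
    with argmin (λ w → ¬? (u ≟ w) ×-dec (e u w Bool.≟ false)) (dist u) (x , u≢x , ¬ux)
  ... | m , (u≢m , ¬um) , m-first = m , u≢m , ¬um , cong ℕ.suc (Σv-cong (cong 𝟙 ∘ before))
    where
    before : ∀ y → e u y ≡ c u y m
    before y = ≡true⇔⇒≡ to from
      where
      to : e u y ≡ true → c u y m ≡ true
      to uy with total (e⇒≢ uy) (λ { refl → true≢false uy ¬um }) u≢m
      ... | inj₁ uym = uym
      ... | inj₂ myu = ⊥-elim (true≢false (convex (rotate (rotate myu)) uy) ¬um)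
      from : c u y m ≡ true → e u y ≡ true
      from uym with true⊎false (e u y)
      ... | inj₁ uy = uy
      ... | inj₂ ¬uy = ⊥-elim (ℕ.<⇒≱ (dist-mono-< uym) (m-first y (distinct₁₂ uym , ¬uy)))

-- The clockwise order on positions

cw⁻ : (u w v : Fin n) → cwᵇ u w v ≡ true →
      (toℕ u < toℕ w × toℕ w < toℕ v) ⊎ (toℕ w < toℕ v × toℕ v < toℕ u) ⊎ (toℕ v < toℕ u × toℕ u < toℕ w)
cw⁻ u w v h
  with toℕ u <ᵇ toℕ w | ℕ.<ᵇ-reflects-< (toℕ u) (toℕ w)
     | toℕ w <ᵇ toℕ v | ℕ.<ᵇ-reflects-< (toℕ w) (toℕ v)
     | toℕ v <ᵇ toℕ u | ℕ.<ᵇ-reflects-< (toℕ v) (toℕ u)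
... | true  | ofʸ p | true  | ofʸ q | _     | _     = inj₁ (p , q)
... | true  | ofʸ p | false | _     | true  | ofʸ r = inj₂ (inj₂ (r , p))
... | false | _     | true  | ofʸ q | true  | ofʸ r = inj₂ (inj₁ (q , r))
cw⁻ u w v () | true  | _ | false | _ | false | _
cw⁻ u w v () | false | _ | true  | _ | false | _
cw⁻ u w v () | false | _ | false | _ | true  | _
cw⁻ u w v () | false | _ | false | _ | false | _

<⇒<ᵇ-true : ∀ {a b} → a < b → (a <ᵇ b) ≡ true
<⇒<ᵇ-true a<b = Equivalence.to Bool.T-≡ (ℕ.<⇒<ᵇ a<b)

cw⁺ : (u w v : Fin n) →
      (toℕ u < toℕ w × toℕ w < toℕ v) ⊎ (toℕ w < toℕ v × toℕ v < toℕ u) ⊎ (toℕ v < toℕ u × toℕ u < toℕ w) →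
      cwᵇ u w v ≡ true
cw⁺ u w v (inj₁ (p , q)) rewrite <⇒<ᵇ-true p | <⇒<ᵇ-true q = refl
cw⁺ u w v (inj₂ (inj₁ (q , r))) rewrite <⇒<ᵇ-true q | <⇒<ᵇ-true r = Bool.∨-zeroʳ _
cw⁺ u w v (inj₂ (inj₂ (r , p))) rewrite <⇒<ᵇ-true r | <⇒<ᵇ-true p =
  trans (cong ((toℕ w <ᵇ toℕ v) ∨_) (Bool.∨-zeroʳ _)) (Bool.∨-zeroʳ _)

cw-isCyclicOrder : IsCyclicOrder (cwᵇ {n})
cw-isCyclicOrder = record
  { rotate = λ {u} {w} {v} h → cw⁺ w v u (rot (cw⁻ u w v h))
  ; asym   = λ {u} {w} {v} h k → asym′ (cw⁻ u w v h) (cw⁻ v w u k)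
  ; total  = total′
  ; chain  = λ {u} {w} {v} {x} h k → cw⁺ u w x (chain′ (cw⁻ u w v h) (cw⁻ u v x k))
  }
  where
  CW : ℕ → ℕ → ℕ → Set
  CW a b c = (a < b × b < c) ⊎ (b < c × c < a) ⊎ (c < a × a < b)

  rot : ∀ {a b c} → CW a b c → CW b c a
  rot (inj₁ p)        = inj₂ (inj₂ p)
  rot (inj₂ (inj₁ q)) = inj₁ q
  rot (inj₂ (inj₂ r)) = inj₂ (inj₁ r)

  asym′ : ∀ {a b c} → CW a b c → CW c b a → ⊥
  asym′ (inj₁ (p , q))        (inj₁ (q′ , _))        = ℕ.<-asym q q′
  asym′ (inj₁ (p , q))        (inj₂ (inj₁ (p′ , _))) = ℕ.<-asym p p′
  asym′ (inj₁ (p , q))        (inj₂ (inj₂ (_ , q′))) = ℕ.<-asym q q′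
  asym′ (inj₂ (inj₁ (q , r))) (inj₁ (q′ , _))        = ℕ.<-asym q q′
  asym′ (inj₂ (inj₁ (q , r))) (inj₂ (inj₁ (_ , r′))) = ℕ.<-asym r r′
  asym′ (inj₂ (inj₁ (q , r))) (inj₂ (inj₂ (r′ , _))) = ℕ.<-asym r r′
  asym′ (inj₂ (inj₂ (r , p))) (inj₁ (_ , p′))        = ℕ.<-asym p p′
  asym′ (inj₂ (inj₂ (r , p))) (inj₂ (inj₁ (p′ , _))) = ℕ.<-asym p p′
  asym′ (inj₂ (inj₂ (r , p))) (inj₂ (inj₂ (r′ , _))) = ℕ.<-asym r r′

  chain′ : ∀ {a b c x} → CW a b c → CW a c x → CW a b x
  chain′ (inj₁ (p , q))        (inj₁ (_ , s))         = inj₁ (p , ℕ.<-trans q s)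
  chain′ (inj₁ (p , q))        (inj₂ (inj₁ (s , t)))  = ⊥-elim (ℕ.<-asym (ℕ.<-trans p q) (ℕ.<-trans s t))
  chain′ (inj₁ (p , q))        (inj₂ (inj₂ (t , _)))  = inj₂ (inj₂ (t , p))
  chain′ (inj₂ (inj₁ (q , r))) (inj₁ (r′ , _))        = ⊥-elim (ℕ.<-asym r r′)
  chain′ (inj₂ (inj₁ (q , r))) (inj₂ (inj₁ (s , t)))  = inj₂ (inj₁ (ℕ.<-trans q s , t))
  chain′ (inj₂ (inj₁ (q , r))) (inj₂ (inj₂ (_ , r′))) = ⊥-elim (ℕ.<-asym r r′)
  chain′ (inj₂ (inj₂ (r , p))) (inj₁ (r′ , _))        = ⊥-elim (ℕ.<-asym r r′)
  chain′ (inj₂ (inj₂ (r , p))) (inj₂ (inj₁ (_ , t)))  = inj₂ (inj₂ (t , p))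
  chain′ (inj₂ (inj₂ (r , p))) (inj₂ (inj₂ (_ , r′))) = ⊥-elim (ℕ.<-asym r r′)

  total′ : ∀ {n} {u w v : Fin n} → u ≢ w → w ≢ v → u ≢ v → cwᵇ u w v ≡ true ⊎ cwᵇ v w u ≡ true
  total′ {u = u} {w} {v} u≢w w≢v u≢v
    with ℕ.<-cmp (toℕ u) (toℕ w) | ℕ.<-cmp (toℕ w) (toℕ v) | ℕ.<-cmp (toℕ u) (toℕ v)
  ... | tri≈ _ p _ | _ | _ = ⊥-elim (u≢w (toℕ-injective p))
  ... | _ | tri≈ _ p _ | _ = ⊥-elim (w≢v (toℕ-injective p))
  ... | _ | _ | tri≈ _ p _ = ⊥-elim (u≢v (toℕ-injective p))
  ... | tri< p _ _ | tri< q _ _ | tri< _ _ _ = inj₁ (cw⁺ u w v (inj₁ (p , q)))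
  ... | tri< p _ _ | tri< q _ _ | tri> _ _ r = inj₁ (cw⁺ u w v (inj₁ (p , q)))
  ... | tri< p _ _ | tri> _ _ q | tri< r _ _ = inj₂ (cw⁺ v w u (inj₂ (inj₂ (r , q))))
  ... | tri< p _ _ | tri> _ _ q | tri> _ _ r = inj₁ (cw⁺ u w v (inj₂ (inj₂ (r , p))))
  ... | tri> _ _ p | tri< q _ _ | tri< r _ _ = inj₂ (cw⁺ v w u (inj₂ (inj₁ (p , r))))
  ... | tri> _ _ p | tri< q _ _ | tri> _ _ r = inj₁ (cw⁺ u w v (inj₂ (inj₁ (q , r))))
  ... | tri> _ _ p | tri> _ _ q | _ = inj₂ (cw⁺ v w u (inj₁ (q , p)))

-- Second-order expansion of the path polynomial

sum₂ : (Fin n → Fin n → ℤ) → ℤ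
sum₂ f = sum λ u → sum λ w → f u w

module PathPolynomial {n} (c : Fin n → Fin n → Fin n → Bool)
  (c-rotate : ∀ u w v → c u w v ≡ c w v u) where

  sum₃ : (Fin n → Fin n → Fin n → ℤ) → ℤ
  sum₃ g = sum λ u → sum λ w → sum λ v → ⟦ c u w v ⟧ * g u w v

  sum₃-cong : ∀ {f g} → (∀ u w v → f u w v ≡ g u w v) → sum₃ f ≡ sum₃ g
  sum₃-cong f≗g = sum-cong-≗ {n} λ u → sum-cong-≗ {n} λ w → sum-cong-≗ {n} λ v → cong (⟦ c u w v ⟧ *_) (f≗g u w v)

  sum₃-+ : ∀ f g → sum₃ (λ u w v → f u w v + g u w v) ≡ sum₃ f + sum₃ g
  sum₃-+ f g = begin
    sum₃ (λ u w v → f u w v + g u w v)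
      ≡⟨ (sum-cong-≗ {n} λ u → sum-cong-≗ {n} λ w → trans
           (sum-cong-≗ {n} λ v → ℤ.*-distribˡ-+ ⟦ c u w v ⟧ (f u w v) (g u w v)) (∑-distrib-+ {n} _ _)) ⟩
    (sum λ u → sum λ w → (sum λ v → ⟦ c u w v ⟧ * f u w v) + (sum λ v → ⟦ c u w v ⟧ * g u w v))
      ≡⟨ (sum-cong-≗ {n} λ u → ∑-distrib-+ {n} _ _) ⟩
    (sum λ u → (sum λ w → sum λ v → ⟦ c u w v ⟧ * f u w v) + (sum λ w → sum λ v → ⟦ c u w v ⟧ * g u w v))
      ≡⟨ ∑-distrib-+ {n} _ _ ⟩
    sum₃ f + sum₃ g ∎
    where open ≡-Reasoning

  sum₃-rotate : ∀ g → sum₃ g ≡ sum₃ (λ u w v → g w v u)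
  sum₃-rotate g = sym (begin
    (sum λ u → sum λ w → sum λ v → ⟦ c u w v ⟧ * g w v u)
      ≡⟨ ∑-comm {n} {n} _ ⟩
    (sum λ w → sum λ u → sum λ v → ⟦ c u w v ⟧ * g w v u)
      ≡⟨ (sum-cong-≗ {n} λ w → ∑-comm {n} {n} _) ⟩
    (sum λ w → sum λ v → sum λ u → ⟦ c u w v ⟧ * g w v u)
      ≡⟨ (sum-cong-≗ {n} λ w → sum-cong-≗ {n} λ v → sum-cong-≗ {n} λ u → cong (λ b → ⟦ b ⟧ * g w v u) (c-rotate u w v)) ⟩
    sum₃ g ∎)
    where open ≡-Reasoning

  -- The product detects paths that do not close to a directed triangle; the linear term then
  -- removes the transitive triangles. Subtracting `e u v` alone is enough because convexity makes
  -- it imply the other two edges, and this keeps the degree at three.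
  paths : (Fin n → Fin n → ℤ) → ℤ
  paths e = sum₃ λ u w v → e u w * e w v * (1ℤ - e v u) - e u v

  paths-cong : ∀ {e e′} → (∀ u v → e u v ≡ e′ u v) → paths e ≡ paths e′
  paths-cong e≗e′ = sum₃-cong λ u w v → cong₂ _-_
    (cong₂ _*_ (cong₂ _*_ (e≗e′ u w) (e≗e′ w v)) (cong (λ z → 1ℤ - z) (e≗e′ v u))) (e≗e′ u v)

  -- A difference quotient that keeps the terms of higher order in `h`, so that the expansion below
  -- is exact. The coefficient 3 collects the three rotations of a cubic monomial, and a product of
  -- two consecutive changes is charged to the first of them.
  slope : (e h : Fin n → Fin n → ℤ) → Fin n → Fin n → ℤ
  slope e h u w =
    sum (λ v → ⟦ c u w v ⟧ * (e w v + e v u - + 3 * (e w v * e v u) + h w v * (1ℤ - + 3 * e v u - h v u)))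
    - sum (λ v → ⟦ c u v w ⟧)

  -- Every monomial of the expansion is rotated until it carries the factor h u w.
  paths-expand : ∀ e h → paths (λ u v → e u v + h u v) ≡ paths e + sum₂ (λ u w → h u w * slope e h u w)
  paths-expand e h = begin
    paths (λ u v → e u v + h u v)
      ≡⟨ (sum₃-cong λ u w v → expand (e u w) (e w v) (e v u) (e u v) (h u w) (h w v) (h v u) (h u v)) ⟩
    sum₃ (λ u w v → A u w v + B u w v + C u w v)
      ≡⟨ trans (sum₃-+ _ _) (cong (λ z → z + sum₃ C) (sum₃-+ _ _)) ⟩
    sum₃ A + sum₃ B + sum₃ C
      ≡⟨ cong₂ (λ b c → sum₃ A + b + c) (sum₃-rotate B) (trans (sum₃-rotate C) (sum₃-rotate (λ u w v → C w v u))) ⟩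
    sum₃ A + sum₃ (λ u w v → B w v u) + sum₃ (λ u w v → C v u w)
      ≡⟨ sym (trans (sum₃-+ _ _) (cong (λ z → z + sum₃ (λ u w v → C v u w)) (sum₃-+ _ _))) ⟩
    sum₃ (λ u w v → A u w v + B w v u + C v u w)
      ≡⟨ (sum₃-cong λ u w v → collect (e u w) (e w v) (e v u) (e u v) (h u w) (h w v) (h v u) (h u v)) ⟩
    sum₃ (λ u w v → (e u w * e w v * (1ℤ - e v u) - e u v) + (h u w * K u w v + - 1ℤ * h u v))
      ≡⟨ trans (sum₃-+ _ _) (cong (λ z → paths e + z) (sum₃-+ _ _)) ⟩
    paths e + (sum₃ (λ u w v → h u w * K u w v) + sum₃ (λ u w v → - 1ℤ * h u v))
      ≡⟨ cong (λ z → paths e + z) (cong₂ _+_ factor₁ factor₂) ⟩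
    paths e + (sum₂ (λ u w → h u w * sum (λ v → ⟦ c u w v ⟧ * K u w v))
      + sum₂ (λ u w → h u w * (- 1ℤ * sum (λ v → ⟦ c u v w ⟧))))
      ≡⟨ cong (λ z → paths e + z) (sym (trans (sum-cong-≗ {n} λ u → ∑-distrib-+ {n} _ _) (∑-distrib-+ {n} _ _))) ⟩
    paths e + sum₂ (λ u w → h u w * sum (λ v → ⟦ c u w v ⟧ * K u w v) + h u w * (- 1ℤ * sum (λ v → ⟦ c u v w ⟧)))
      ≡⟨ cong (λ z → paths e + z) (sum-cong-≗ {n} λ u → sum-cong-≗ {n} λ w → distrib (h u w) _ _) ⟩
    paths e + sum₂ (λ u w → h u w * slope e h u w) ∎
    where
    open ≡-Reasoning
    A B C K : Fin n → Fin n → Fin n → ℤ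
    A u w v = (e u w * e w v * (1ℤ - e v u) - e u v)
      + (h u w * (e w v * (1ℤ - e v u)) + h u w * h w v * (1ℤ - e v u - h v u) - h u v)
    B u w v = - (h v u * (e u w * e w v)) - h u w * e w v * h v u
    C u w v = h w v * (e u w * (1ℤ - e v u)) - e u w * h w v * h v u
    K u w v = e w v + e v u - + 3 * (e w v * e v u) + h w v * (1ℤ - + 3 * e v u - h v u)

    expand : ∀ a b c d a′ b′ c′ d′ →
      (a + a′) * (b + b′) * (1ℤ - (c + c′)) - (d + d′) ≡
      ((a * b * (1ℤ - c) - d) + (a′ * (b * (1ℤ - c)) + a′ * b′ * (1ℤ - c - c′) - d′))
      + (- (c′ * (a * b)) - a′ * b * c′) + (b′ * (a * (1ℤ - c)) - a * b′ * c′)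
    expand = solve-∀

    collect : ∀ a b c d a′ b′ c′ d′ →
      ((a * b * (1ℤ - c) - d) + (a′ * (b * (1ℤ - c)) + a′ * b′ * (1ℤ - c - c′) - d′))
      + (- (a′ * (b * c)) - b′ * c * a′) + (a′ * (c * (1ℤ - b)) - c * a′ * b′) ≡
      (a * b * (1ℤ - c) - d) + (a′ * (b + c - + 3 * (b * c) + b′ * (1ℤ - + 3 * c - c′)) + - 1ℤ * d′)
    collect = solve-∀

    distrib : ∀ a x y → a * x + a * (- 1ℤ * y) ≡ a * (x - y)
    distrib = solve-∀

    swap : ∀ a b x → a * (b * x) ≡ b * (a * x)
    swap = solve-∀

    swap-1 : ∀ a x → a * (- 1ℤ * x) ≡ x * (- 1ℤ * a)
    swap-1 = solve-∀

    factor₁ : sum₃ (λ u w v → h u w * K u w v) ≡ sum₂ (λ u w → h u w * sum (λ v → ⟦ c u w v ⟧ * K u w v))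
    factor₁ = sum-cong-≗ {n} λ u → sum-cong-≗ {n} λ w → trans
      (sum-cong-≗ {n} λ v → swap ⟦ c u w v ⟧ (h u w) (K u w v)) (sum-scale {n} (h u w) _)

    factor₂ : sum₃ (λ u w v → - 1ℤ * h u v) ≡ sum₂ (λ u w → h u w * (- 1ℤ * sum (λ v → ⟦ c u v w ⟧)))
    factor₂ = sum-cong-≗ {n} λ u → trans (∑-comm {n} {n} _) (sum-cong-≗ {n} λ w → trans
      (sum-cong-≗ {n} λ v → swap-1 ⟦ c u v w ⟧ (h u w))
      (trans (sum-scale {n} (h u w) _) (cong (h u w *_) (sum-scale {n} (- 1ℤ) _))))

-- Unlike cwᵇ u w v ≡ true, the record type determines u, w and v by unification.
record CW {n} (u w v : Fin n) : Set where
  constructor cw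
  field
    holds : cwᵇ u w v ≡ true
open CW

private module Cyc {n} = CyclicOrder {n} cw-isCyclicOrder
open module Poly {n} = PathPolynomial {n} cwᵇ Cyc.c-rotate

rotate : {u w v : Fin n} → CW u w v → CW w v u
rotate {u = u} {w} {v} (cw h) = cw (Cyc.rotate {u = u} {w} {v} h)

chain : {u w v x : Fin n} → CW u w v → CW u v x → CW u w x
chain {u = u} {w} {v} {x} (cw h) (cw k) = cw (Cyc.chain {u = u} {w} {v} {x} h k)

total : {u w v : Fin n} → u ≢ w → w ≢ v → u ≢ v → CW u w v ⊎ CW v w u
total u≢w w≢v u≢v = Sum.map cw cw (Cyc.total u≢w w≢v u≢v)

distinct₁₂ : {u w v : Fin n} → CW u w v → u ≢ w
distinct₁₂ {u = u} {w} {v} (cw h) = Cyc.distinct₁₂ {u = u} {w} {v} h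

distinct₂₃ : {u w v : Fin n} → CW u w v → w ≢ v
distinct₂₃ {u = u} {w} {v} (cw h) = Cyc.distinct₂₃ {u = u} {w} {v} h

distinct₁₃ : {u w v : Fin n} → CW u w v → u ≢ v
distinct₁₃ {u = u} {w} {v} (cw h) = Cyc.distinct₁₃ {u = u} {w} {v} h

d-flip : {u v : Fin n} → u ≢ v → d u v ℕ.+ d v u ≡ n
d-flip = Cyc.dist-flip

d-mono-< : {u w v : Fin n} → CW u w v → d u w < d u v
d-mono-< {u = u} {w} {v} (cw h) = Cyc.dist-mono-< {u = u} {w} {v} h

d-mono-<ʳ : {u w v : Fin n} → CW u w v → d w v < d u v
d-mono-<ʳ {u = u} {w} {v} (cw h) =
  CyclicOrder.dist-mono-< (reverse cw-isCyclicOrder) {u = v} {w} {u} h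

-- Admissible digraphs and their induced paths

weight : Digraph n → Fin n → Fin n → ℤ
weight G u v = ⟦ edge G u v ⟧

edge⇒≢ : (G : Digraph n) {u v : Fin n} → edge G u v ≡ true → u ≢ v
edge⇒≢ G uv refl = true≢false uv (loopless G _)

≢⇒≢ᵇ : {u v : Fin n} → u ≢ v → (u ≢ᵇ v) ≡ true
≢⇒≢ᵇ u≢v = cong not (≢⇒≡ᶠ-false u≢v)

record NonEdge {n} (G : Digraph n) (u v : Fin n) : Set where
  constructor nonEdge
  field
    distinct : u ≢ v
    ¬forth   : edge G u v ≡ false
    ¬back    : edge G v u ≡ false
open NonEdge

nonEdge⁺ : {G : Digraph n} {u v : Fin n} → NonEdge G u v → nonEdgeᵇ G u v ≡ true
nonEdge⁺ (nonEdge u≢v ¬uv ¬vu) rewrite ≢⇒≢ᵇ u≢v | ¬uv | ¬vu = refl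

nonEdge⁻ : (G : Digraph n) (u v : Fin n) → nonEdgeᵇ G u v ≡ true → NonEdge G u v
nonEdge⁻ G u v h with u ≟ v | edge G u v in ¬uv | edge G v u in ¬vu
... | no u≢v | false | false = nonEdge u≢v ¬uv ¬vu

cases : (G : Digraph n) {u v : Fin n} → u ≢ v →
  edge G u v ≡ true ⊎ edge G v u ≡ true ⊎ NonEdge G u v
cases G {u} {v} u≢v with true⊎false (edge G u v) | true⊎false (edge G v u)
... | inj₁ uv  | _        = inj₁ uv
... | inj₂ _   | inj₁ vu  = inj₂ (inj₁ vu)
... | inj₂ ¬uv | inj₂ ¬vu = inj₂ (inj₂ (nonEdge u≢v ¬uv ¬vu))

module Admissible {n} (G : Digraph n) (adm : Admissible G) where

  2free : ∀ {u v} → edge G u v ≡ true → edge G v u ≡ false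
  2free {u} {v} uv = ¬true⇒false λ vu → proj₁ adm u v (uv , vu)

  convexˡ : ∀ {u v w} → CW u v w → edge G u w ≡ true → edge G u v ≡ true
  convexˡ uvw uw = proj₁ (proj₂ adm _ _ _ (Equivalence.from Bool.T-≡ (holds uvw)) uw)

  convexʳ : ∀ {u v w} → CW u v w → edge G u w ≡ true → edge G v w ≡ true
  convexʳ uvw uw = proj₂ (proj₂ adm _ _ _ (Equivalence.from Bool.T-≡ (holds uvw)) uw)

  -- Induced paths only run clockwise: if `v`, `w`, `u` are clockwise then `v` lies between `u` and
  -- `w`, and an edge `uw` forces the edge `uv`.
  P̃₃≡paths : + P̃₃ G ≡ paths (weight G)
  P̃₃≡paths =
    trans (Σv-sum {n} _) (sum-cong-≗ {n} λ u →
    trans (Σv-sum {n} _) (sum-cong-≗ {n} λ w →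
    trans (Σv-sum {n} _) (sum-cong-≗ {n} λ v → pointwise u w v)))
    where
    Contribution : (c p q r uw wv uv vu : Bool) → Set
    Contribution c p q r uw wv uv vu =
      ⟦ p ∧ q ∧ r ∧ uw ∧ wv ∧ not uv ∧ not vu ⟧ ≡ ⟦ c ⟧ * (⟦ uw ⟧ * ⟦ wv ⟧ * (1ℤ - ⟦ vu ⟧) - ⟦ uv ⟧)

    -- A transitive triangle contributes 1 - 1 = 0 to the polynomial.
    clockwise : ∀ {c p q r uw wv uv vu} → c ≡ true → p ≡ true → q ≡ true → r ≡ true →
      (uv ≡ true → uw ≡ true × wv ≡ true × vu ≡ false) → Contribution c p q r uw wv uv vu
    clockwise {uv = true} refl refl refl refl h with refl , refl , refl ← h refl = refl
    clockwise {uw = true}  {true}  {false} {true}  refl refl refl refl _ = refl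
    clockwise {uw = true}  {true}  {false} {false} refl refl refl refl _ = refl
    clockwise {uw = true}  {false} {false}         refl refl refl refl _ = refl
    clockwise {uw = false} {_}     {false}         refl refl refl refl _ = refl

    otherwise : ∀ {c p q r uw wv uv vu} → c ≡ false →
      (p ≡ true → q ≡ true → r ≡ true → uw ≡ true → uv ≡ true) → Contribution c p q r uw wv uv vu
    otherwise {p = false} refl _ = refl
    otherwise {p = true} {false} refl _ = refl
    otherwise {p = true} {true} {false} refl _ = refl
    otherwise {p = true} {true} {true} {false} refl _ = refl
    otherwise {p = true} {true} {true} {true} {wv} refl h with refl ← h refl refl refl refl =
      cong ⟦_⟧ (Bool.∧-zeroʳ wv)

    ≢ᵇ⇒≢ : ∀ {u v : Fin n} → (u ≢ᵇ v) ≡ true → u ≢ v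
    ≢ᵇ⇒≢ {u} h refl = true≢false h (cong not (≡ᶠ-refl u))

    pointwise : ∀ u w v → Contribution (cwᵇ u w v) (u ≢ᵇ w) (w ≢ᵇ v) (u ≢ᵇ v)
      (edge G u w) (edge G w v) (edge G u v) (edge G v u)
    pointwise u w v with true⊎false (cwᵇ u w v)
    ... | inj₁ c-uwv = let uwv = cw c-uwv in clockwise c-uwv (≢⇒≢ᵇ (distinct₁₂ uwv)) (≢⇒≢ᵇ (distinct₂₃ uwv)) (≢⇒≢ᵇ (distinct₁₃ uwv))
      λ uv → convexˡ uwv uv , convexʳ uwv uv , 2free uv
    ... | inj₂ ¬uwv = otherwise ¬uwv other-way
      where
      other-way : (u ≢ᵇ w) ≡ true → (w ≢ᵇ v) ≡ true → (u ≢ᵇ v) ≡ true → edge G u w ≡ true → edge G u v ≡ true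
      other-way u≢w w≢v u≢v uw with total (≢ᵇ⇒≢ u≢w) (≢ᵇ⇒≢ w≢v) (≢ᵇ⇒≢ u≢v)
      ... | inj₁ uwv = ⊥-elim (true≢false (holds uwv) ¬uwv)
      ... | inj₂ vwu = convexˡ (rotate (rotate vwu)) uw

-- Moves between shortest non-edges and longest edges

record Extremal {n} (G : Digraph n) (a b : ℕ) : Set where
  field
    a<b       : a < b
    a≤nonEdge : ∀ {u v} → NonEdge G u v → a ≤ d u v
    edge≤b    : ∀ {u v} → edge G u v ≡ true → d u v ≤ b

-- Both orientations of a non-edge can have length `a`, namely if `n = 2a`; `A-asym` prevents
-- inserting both, which would break 2-freeness.
record Move {n} (G : Digraph n) (a b : ℕ) (A B : Fin n → Fin n → Bool) : Set where
  field
    A-shortest : ∀ {u v} → A u v ≡ true → NonEdge G u v × d u v ≡ a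
    B-longest  : ∀ {u v} → B u v ≡ true → edge G u v ≡ true × d u v ≡ b
    A-asym     : ∀ {u v} → A u v ≡ true → A v u ≡ true → ⊥

module Perturbation {n} (G : Digraph n) (adm : Admissible G) {a b : ℕ} (ext : Extremal G a b)
  {A B : Fin n → Fin n → Bool} (move : Move G a b A B) where

  open Admissible G adm
  open Extremal ext
  open Move move

  A⇒¬edge : ∀ {u v} → A u v ≡ true → edge G u v ≡ false
  A⇒¬edge uv = ¬forth (proj₁ (A-shortest uv))

  edge⇒¬A : ∀ {u v} → edge G u v ≡ true → A u v ≡ false
  edge⇒¬A uv = ¬true⇒false λ Auv → true≢false uv (A⇒¬edge Auv)

  edge′ : Fin n → Fin n → Bool
  edge′ u v = (edge G u v ∧ not (B u v)) ∨ A u v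

  H : Digraph n
  H = record
    { edge     = edge′
    ; loopless = λ u → trans (cong (λ e → e ∧ not (B u u) ∨ A u u) (loopless G u))
        (¬true⇒false λ Auu → A-asym Auu Auu)
    }

  edge′⁻ : ∀ u v → edge′ u v ≡ true → (edge G u v ≡ true × B u v ≡ false) ⊎ A u v ≡ true
  edge′⁻ u v h with edge G u v | B u v
  ... | true  | false = inj₁ (refl , refl)
  ... | true  | true  = inj₂ h
  ... | false | _     = inj₂ h

  shorter⇒edge′ : ∀ {u v} → edge G u v ≡ true → d u v < b → edge′ u v ≡ true
  shorter⇒edge′ {u} {v} uv short
    rewrite uv | ¬true⇒false {B u v} (λ Buv → ℕ.<⇒≢ short (proj₂ (B-longest Buv))) = refl

  -- If a pair inside a shortest non-edge uw were joined by an edge going the other way round, then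
  -- that edge would contain wu, so wu would be an edge.
  inside-A : ∀ {u v w} → CW u v w → A u w ≡ true → edge G u v ≡ true × edge G v w ≡ true
  inside-A {u} {v} {w} uvw Auw = first , second
    where
    ¬wu : edge G w u ≡ false
    ¬wu = ¬back (proj₁ (A-shortest Auw))
    first : edge G u v ≡ true
    first with cases G (distinct₁₂ uvw)
    ... | inj₁ uv = uv
    ... | inj₂ (inj₁ vu) = ⊥-elim (true≢false (convexʳ (rotate uvw) vu) ¬wu)
    ... | inj₂ (inj₂ ¬uv) = ⊥-elim (ℕ.<⇒≱ (d-mono-< uvw)
      (ℕ.≤-trans (ℕ.≤-reflexive (proj₂ (A-shortest Auw))) (a≤nonEdge ¬uv)))
    second : edge G v w ≡ true
    second with cases G (distinct₂₃ uvw)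
    ... | inj₁ vw = vw
    ... | inj₂ (inj₁ wv) = ⊥-elim (true≢false (convexˡ (rotate (rotate uvw)) wv) ¬wu)
    ... | inj₂ (inj₂ ¬vw) = ⊥-elim (ℕ.<⇒≱ (d-mono-<ʳ uvw)
      (ℕ.≤-trans (ℕ.≤-reflexive (proj₂ (A-shortest Auw))) (a≤nonEdge ¬vw)))

  edge′≤b : ∀ u v → edge′ u v ≡ true → d u v ≤ b
  edge′≤b u v uv with edge′⁻ u v uv
  ... | inj₁ (uv , _) = edge≤b uv
  ... | inj₂ Auv = ℕ.≤-trans (ℕ.≤-reflexive (proj₂ (A-shortest Auv))) (ℕ.<⇒≤ a<b)

  -- No edge of `H` is longer than `b`, so the pairs strictly inside one are shorter than `b`. They
  -- are edges of `G`, by convexity or by `inside-A`, and survive because only edges of length `b`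
  -- are deleted.
  H-admissible : Admissible H
  H-admissible = twoFree , interval
    where
    twoFree : TwoFree H
    twoFree u v (uv , vu) with edge′⁻ u v uv | edge′⁻ v u vu
    ... | inj₁ (uv , _) | inj₁ (vu , _) = proj₁ adm u v (uv , vu)
    ... | inj₁ (uv , _) | inj₂ Avu = true≢false uv (¬back (proj₁ (A-shortest Avu)))
    ... | inj₂ Auv | inj₁ (vu , _) = true≢false vu (¬back (proj₁ (A-shortest Auv)))
    ... | inj₂ Auv | inj₂ Avu = A-asym Auv Avu

    interval : CircularInterval H
    interval u v w T-uvw uw =
      shorter⇒edge′ (proj₁ inside) (ℕ.<-≤-trans (d-mono-< uvw) (edge′≤b u w uw)) ,
      shorter⇒edge′ (proj₂ inside) (ℕ.<-≤-trans (d-mono-<ʳ uvw) (edge′≤b u w uw))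
      where
      uvw : CW u v w
      uvw = cw (Equivalence.to Bool.T-≡ T-uvw)
      inside : edge G u v ≡ true × edge G v w ≡ true
      inside with edge′⁻ u w uw
      ... | inj₁ (uw , _) = convexˡ uvw uw , convexʳ uvw uw
      ... | inj₂ Auw      = inside-A uvw Auw

  weight-H : ∀ u v → weight H u v ≡ weight G u v + (⟦ A u v ⟧ - ⟦ B u v ⟧)
  weight-H u v with true⊎false (A u v) | true⊎false (B u v)
  ... | inj₁ Auv | inj₁ Buv = ⊥-elim (true≢false (proj₁ (B-longest Buv)) (A⇒¬edge Auv))
  ... | inj₁ Auv | inj₂ ¬B rewrite Auv | ¬B | A⇒¬edge Auv = refl
  ... | inj₂ ¬A | inj₁ Buv rewrite ¬A | Buv | proj₁ (B-longest Buv) = refl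
  ... | inj₂ ¬A | inj₂ ¬B rewrite ¬A | ¬B with edge G u v
  ...   | true  = refl
  ...   | false = refl

  -- Deleting a longest edge uv creates the non-edges uv and vu; the hypothesis keeps vu from being short.
  ξ-decreases : (∀ {u v} → B u v ≡ true → b ℕ.+ b ≤ n) →
    ∀ {u v w x} → edge G u v ≡ true → d u v ≡ b → NonEdge G w x → d w x ≡ a →
    (A w x ≡ true ⊎ B u v ≡ true) → ξ H < ξ G
  ξ-decreases 2b≤n {u₀} {v₀} {w₀} {x₀} uv duv≡b ¬wx dwx≡a A⊎B =
    Σv-mono-< (λ u → Σv-mono-≤ λ v → Σv-mono-≤ λ w → Σv-mono-≤ λ x → mono u v w x) u₀
    (Σv-mono-< (λ v → Σv-mono-≤ λ w → Σv-mono-≤ λ x → mono u₀ v w x) v₀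
    (Σv-mono-< (λ w → Σv-mono-≤ λ x → mono u₀ v₀ w x) w₀
    (Σv-mono-< (λ x → mono u₀ v₀ w₀ x) x₀ strict)))
    where
    inversion inversion′ : (u v w x : Fin n) → Bool
    inversion  u v w x = edge G u v ∧ nonEdgeᵇ G w x ∧ (d w x <ᵇ d u v)
    inversion′ u v w x = edge H u v ∧ nonEdgeᵇ H w x ∧ (d w x <ᵇ d u v)

    old : ∀ u v w x → inversion′ u v w x ≡ true → inversion u v w x ≡ true
    old u v w x h with ∧-true⁻ {edge H u v} h
    ... | uv′ , h′ with ∧-true⁻ {nonEdgeᵇ H w x} h′
    ... | ¬wx′ , lt = cong₂ _∧_ uv-edge (cong₂ _∧_ (nonEdge⁺ wx-nonEdge) lt)
      where
      wx<uv : d w x < d u v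
      wx<uv = ℕ.<ᵇ⇒< _ _ (Equivalence.from Bool.T-≡ lt)
      wx<b : d w x < b
      wx<b = ℕ.<-≤-trans wx<uv (edge′≤b u v uv′)
      wx-nonEdge′ : NonEdge H w x
      wx-nonEdge′ = nonEdge⁻ H w x ¬wx′
      removed : ∀ {y z} → edge G y z ≡ true → edge′ y z ≡ false → B y z ≡ true
      removed {y} {z} yz ¬yz′ with true⊎false (B y z)
      ... | inj₁ Byz = Byz
      ... | inj₂ ¬B rewrite yz | ¬B with () ← ¬yz′
      wx-nonEdge : NonEdge G w x
      wx-nonEdge with cases G (distinct wx-nonEdge′)
      -- A deleted edge has length `b`, and no edge of `H` is longer, so it is in no inversion as a
      -- non-edge.
      ... | inj₁ wx = ⊥-elim (ℕ.<⇒≢ wx<b (proj₂ (B-longest (removed wx (¬forth wx-nonEdge′)))))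
      ... | inj₂ (inj₁ xw) = ⊥-elim (ℕ.<⇒≱ (ℕ.+-mono-<-≤ wx<b (ℕ.≤-reflexive (proj₂ (B-longest Bxw))))
            (ℕ.≤-trans (2b≤n Bxw) (ℕ.≤-reflexive (sym (d-flip (distinct wx-nonEdge′))))))
        where Bxw = removed xw (¬back wx-nonEdge′)
      ... | inj₂ (inj₂ ¬wx) = ¬wx
      uv-edge : edge G u v ≡ true
      uv-edge with edge′⁻ u v uv′
      ... | inj₁ (uv , _) = uv
      -- An inserted edge has length `a`, and no non-edge is shorter.
      ... | inj₂ Auv = ⊥-elim (ℕ.<⇒≱ wx<uv
        (ℕ.≤-trans (ℕ.≤-reflexive (proj₂ (A-shortest Auv))) (a≤nonEdge wx-nonEdge)))

    mono : ∀ u v w x → 𝟙 (inversion′ u v w x) ≤ 𝟙 (inversion u v w x)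
    mono u v w x = 𝟙-mono (old u v w x)

    is-inversion : inversion u₀ v₀ w₀ x₀ ≡ true
    is-inversion = cong₂ _∧_ uv (cong₂ _∧_ (nonEdge⁺ ¬wx) (<⇒<ᵇ-true (subst₂ _<_ (sym dwx≡a) (sym duv≡b) a<b)))

    not-inversion′ : inversion′ u₀ v₀ w₀ x₀ ≡ false
    not-inversion′ = ¬true⇒false λ h → refute A⊎B (∧-true⁻ {edge H u₀ v₀} h)
      where
      refute : A w₀ x₀ ≡ true ⊎ B u₀ v₀ ≡ true →
               edge′ u₀ v₀ ≡ true × nonEdgeᵇ H w₀ x₀ ∧ (d w₀ x₀ <ᵇ d u₀ v₀) ≡ true → ⊥
      refute (inj₁ Awx) (_ , h) = true≢false
        (trans (cong ((edge G w₀ x₀ ∧ not (B w₀ x₀)) ∨_) Awx) (Bool.∨-zeroʳ _))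
        (¬forth (nonEdge⁻ H w₀ x₀ (proj₁ (∧-true⁻ {nonEdgeᵇ H w₀ x₀} h))))
      refute (inj₂ Buv) (h , _) with edge′⁻ u₀ v₀ h
      ... | inj₁ (_ , ¬B) = true≢false Buv ¬B
      ... | inj₂ Auv = true≢false Auv (edge⇒¬A uv)

    strict : 𝟙 (inversion′ u₀ v₀ w₀ x₀) < 𝟙 (inversion u₀ v₀ w₀ x₀)
    strict = subst₂ (λ i j → 𝟙 i < 𝟙 j) (sym not-inversion′) (sym is-inversion) (s≤s z≤n)

-- Linear arithmetic over the integers

0≤+ : ∀ {x y} → 0ℤ ≤ᶻ x → 0ℤ ≤ᶻ y → 0ℤ ≤ᶻ x + y
0≤+ = ℤ.+-mono-≤

0≤* : ∀ k {x} → 0ℤ ≤ᶻ x → 0ℤ ≤ᶻ + k * x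
0≤* k {x} 0≤x = subst (_≤ᶻ (+ k * x)) (ℤ.*-zeroʳ (+ k)) (ℤ.*-monoˡ-≤-nonNeg (+ k) 0≤x)

0≤-≡ : ∀ {x y} → 0ℤ ≤ᶻ x → x ≡ y → 0ℤ ≤ᶻ y
0≤-≡ 0≤x refl = 0≤x

-1-negative : ∀ {x} → 0ℤ ≤ᶻ x → x ≡ - 1ℤ → ⊥
-1-negative () refl

≤⇒0≤ : ∀ {i j} → i ≤ j → 0ℤ ≤ᶻ + j - + i
≤⇒0≤ i≤j = ℤ.i≤j⇒0≤j-i (+≤+ i≤j)

0≤⇒≤ : ∀ {i j} → 0ℤ ≤ᶻ + j - + i → i ≤ j
0≤⇒≤ 0≤j-i = ℤ.drop‿+≤+ (ℤ.0≤i-j⇒j≤i 0≤j-i)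

-- If `x ≤ - 1` the left-hand side is at most `- 1`. All gains by integrality in the degree
-- estimates come from here.
0≤-round : ∀ k x → 0ℤ ≤ᶻ (1ℤ + + k) * x + + k → 0ℤ ≤ᶻ x
0≤-round k x h with ℤ.≤-total 0ℤ x
... | inj₁ 0≤x = 0≤x
... | inj₂ x≤0 with ℤ.<-cmp x 0ℤ
...   | tri≈ _ x≡0 _ = ℤ.≤-reflexive (sym x≡0)
...   | tri> _ _ 0<x = ℤ.<⇒≤ 0<x
...   | tri< x<0 _ _ = ⊥-elim (-1-negative
        (0≤+ h (0≤* (ℕ.suc k) (ℤ.i≤j⇒0≤j-i (ℤ.i<j⇒suc[i]≤j x<0)))) (identity (+ k) x))
  where
  identity : ∀ k x → (1ℤ + k) * x + k + (1ℤ + k) * (0ℤ - (1ℤ + x)) ≡ - 1ℤ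
  identity = solve-∀

-- `P` is the degree sum at a longest edge and `P′` that at a shortest non-edge. `hL₁` and `hL₂` say
-- in two ways that a deletion does not improve, `hN` that an insertion loses at least 1, and `hP`,
-- `hP′` are degree bounds.
module Bounds {N α β P P′ : ℤ}
  (hL₁ : 0ℤ ≤ᶻ + 3 * (N - β - 1ℤ) - + 2 * P - (β - 1ℤ))
  (hL₂ : 0ℤ ≤ᶻ P - (β - 1ℤ))
  (hN  : 0ℤ ≤ᶻ - 1ℤ - (+ 3 * (N - α - 1ℤ) - + 2 * P′ - (α - 1ℤ)))
  (hP  : 0ℤ ≤ᶻ P - + 2 * (α - 1ℤ))
  (hP′ : 0ℤ ≤ᶻ + 2 * β - P′) where

  -- Adding `hN` and `hL₁` eliminates `N`. Since `hP` and `hP′` give `P′ - P ≤ 2(β - α) + 2`, only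
  -- one unit of slack remains.
  degree-gap : 0ℤ ≤ᶻ P′ - P - (+ 2 * (β - α) + 1ℤ)
  degree-gap = 0≤-round 1 _ (0≤-≡ (0≤+ hN hL₁) (identity N α β P P′))
    where
    identity : ∀ N α β P P′ →
      - 1ℤ - (+ 3 * (N - α - 1ℤ) - + 2 * P′ - (α - 1ℤ)) + (+ 3 * (N - β - 1ℤ) - + 2 * P - (β - 1ℤ))
      ≡ (1ℤ + 1ℤ) * (P′ - P - (+ 2 * (β - α) + 1ℤ)) + 1ℤ
    identity = solve-∀

  2β≤N : 0ℤ ≤ᶻ N - (β + β)
  -- The bracket bounds `P` from below by `β - 2`, and the multiplier 2 matches the coefficient of
  -- `P` in `hL₁`.
  2β≤N = 0≤-round 2 _ (0≤-≡ (0≤+ hL₁ (0≤* 2 (0≤+ hP (0≤+ degree-gap (0≤+ hP′ hL₂))))) (identity N α β P P′))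
    where
    identity : ∀ N α β P P′ →
      + 3 * (N - β - 1ℤ) - + 2 * P - (β - 1ℤ) + + 2 * (P - + 2 * (α - 1ℤ)
        + (P′ - P - (+ 2 * (β - α) + 1ℤ) + (+ 2 * β - P′ + (P - (β - 1ℤ)))))
      ≡ (1ℤ + + 2) * (N - (β + β)) + + 2
    identity = solve-∀

  α+β<N : 0ℤ ≤ᶻ N - + 3 → 0ℤ ≤ᶻ N - (1ℤ + (α + β))
  α+β<N 3≤N = 0≤-round 3 _ (0≤-≡ (0≤+ hL₁ (0≤+ (0≤* 2 hP) 3≤N)) (identity N α β P))
    where
    identity : ∀ N α β P →
      + 3 * (N - β - 1ℤ) - + 2 * P - (β - 1ℤ) + (+ 2 * (P - + 2 * (α - 1ℤ)) + (N - + 3))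
      ≡ (1ℤ + + 3) * (N - (1ℤ + (α + β))) + + 3
    identity = solve-∀

  P′-nearly-maximal : 0ℤ ≤ᶻ + 2 * (β - 1ℤ) - P′ → ⊥
  P′-nearly-maximal h = -1-negative (0≤+ h (0≤+ degree-gap hP)) (identity α β P P′)
    where
    identity : ∀ α β P P′ →
      + 2 * (β - 1ℤ) - P′ + (P′ - P - (+ 2 * (β - α) + 1ℤ) + (P - + 2 * (α - 1ℤ))) ≡ - 1ℤ
    identity = solve-∀

  P-nearly-minimal : 0ℤ ≤ᶻ P - + 2 * α → ⊥
  P-nearly-minimal h = -1-negative (0≤+ h (0≤+ degree-gap hP′)) (identity α β P P′)
    where
    identity : ∀ α β P P′ →
      P - + 2 * α + (P′ - P - (+ 2 * (β - α) + 1ℤ) + (+ 2 * β - P′)) ≡ - 1ℤ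
    identity = solve-∀

-- If P′ - P reaches its maximal value up to rounding, all four bounds are attained.
module Tightness {N α β p q p′ q′ : ℤ}
  (swap-loses : 0ℤ ≤ᶻ (+ 3 * (N - β - 1ℤ) - + 2 * (p + q) - (β - 1ℤ))
                      - (+ 3 * (N - α - 1ℤ) - + 2 * (p′ + q′) - (α - 1ℤ)) - + 3)
  (p≥ : 0ℤ ≤ᶻ 1ℤ + p - α) (q≥ : 0ℤ ≤ᶻ 1ℤ + q - α)
  (p′≤ : 0ℤ ≤ᶻ β - p′) (q′≤ : 0ℤ ≤ᶻ β - q′) where

  -- Apart from the constant 3 the hypothesis is even, so a loss of 3 rounds up to 4. The degree
  -- bounds allow no more, so each of them follows as an equality from `gap` and the other three.
  gap : 0ℤ ≤ᶻ p′ + q′ - (p + q) - (+ 2 * (β - α) + + 2)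
  gap = 0≤-round 1 _ (0≤-≡ swap-loses (identity N α β p q p′ q′))
    where
    identity : ∀ N α β p q p′ q′ →
      (+ 3 * (N - β - 1ℤ) - + 2 * (p + q) - (β - 1ℤ))
      - (+ 3 * (N - α - 1ℤ) - + 2 * (p′ + q′) - (α - 1ℤ)) - + 3
      ≡ (1ℤ + 1ℤ) * (p′ + q′ - (p + q) - (+ 2 * (β - α) + + 2)) + 1ℤ
    identity = solve-∀

  p′≥ : 0ℤ ≤ᶻ p′ - β
  p′≥ = 0≤-≡ (0≤+ gap (0≤+ q′≤ (0≤+ p≥ q≥))) (identity α β p q p′ q′)
    where
    identity : ∀ α β p q p′ q′ → p′ + q′ - (p + q) - (+ 2 * (β - α) + + 2)
      + (β - q′ + (1ℤ + p - α + (1ℤ + q - α))) ≡ p′ - β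
    identity = solve-∀

  q′≥ : 0ℤ ≤ᶻ q′ - β
  q′≥ = 0≤-≡ (0≤+ gap (0≤+ p′≤ (0≤+ p≥ q≥))) (identity α β p q p′ q′)
    where
    identity : ∀ α β p q p′ q′ → p′ + q′ - (p + q) - (+ 2 * (β - α) + + 2)
      + (β - p′ + (1ℤ + p - α + (1ℤ + q - α))) ≡ q′ - β
    identity = solve-∀

  p≤ : 0ℤ ≤ᶻ α - (1ℤ + p)
  p≤ = 0≤-≡ (0≤+ gap (0≤+ p′≤ (0≤+ q′≤ q≥))) (identity α β p q p′ q′)
    where
    identity : ∀ α β p q p′ q′ → p′ + q′ - (p + q) - (+ 2 * (β - α) + + 2)
      + (β - p′ + (β - q′ + (1ℤ + q - α))) ≡ α - (1ℤ + p)
    identity = solve-∀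

  q≤ : 0ℤ ≤ᶻ α - (1ℤ + q)
  q≤ = 0≤-≡ (0≤+ gap (0≤+ p′≤ (0≤+ q′≤ p≥))) (identity α β p q p′ q′)
    where
    identity : ∀ α β p q p′ q′ → p′ + q′ - (p + q) - (+ 2 * (β - α) + + 2)
      + (β - p′ + (β - q′ + (1ℤ + p - α))) ≡ α - (1ℤ + q)
    identity = solve-∀

-- First-order effect of adding or deleting an edge

module Gain {n} (G : Digraph n) (adm : Admissible G) where

  open Admissible G adm

  private
    e : Fin n → Fin n → ℤ
    e = weight G

  open module Out = OutNeighbours cw-isCyclicOrder (edge G) (loopless G)
    (λ {u} {v} {w} uvw → convexˡ {u} {v} {w} (cw uvw)) using (outdeg; last-out; first-non-out) public
  open module In = OutNeighbours (reverse cw-isCyclicOrder) (λ u v → edge G v u) (loopless G)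
    (λ {u} {v} {w} wvu → convexʳ {w} {v} {u} (cw wvu))
    using () renaming (outdeg to indeg; last-out to first-in; first-non-out to last-non-in) public

  -- The part of `slope` that does not depend on the change: the effect on `paths` of inserting `xy`
  -- alone, or the negative of that of deleting it alone.
  gain : Fin n → Fin n → ℤ
  gain x y = sum (λ v → ⟦ cwᵇ x y v ⟧ * (e y v + e v x - + 3 * (e y v * e v x))) - sum (λ v → ⟦ cwᵇ x v y ⟧)

  interaction : (Fin n → Fin n → ℤ) → Fin n → Fin n → ℤ
  interaction h x y = sum λ v → ⟦ cwᵇ x y v ⟧ * (h y v * (1ℤ - + 3 * e v x - h v x))

  slope-split : ∀ h x y → slope e h x y ≡ gain x y + interaction h x y
  slope-split h x y = begin
    slope e h x y
      ≡⟨ cong (λ s → s - inner) (sum-cong-≗ {n} λ v → ℤ.*-distribˡ-+ ⟦ cwᵇ x y v ⟧ _ _) ⟩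
    sum (λ v → ⟦ cwᵇ x y v ⟧ * (e y v + e v x - + 3 * (e y v * e v x))
      + ⟦ cwᵇ x y v ⟧ * (h y v * (1ℤ - + 3 * e v x - h v x))) - inner
      ≡⟨ cong (λ s → s - inner) (∑-distrib-+ {n} _ _) ⟩
    main + interaction h x y - inner
      ≡⟨ move main (interaction h x y) inner ⟩
    gain x y + interaction h x y ∎
    where
    open ≡-Reasoning
    main inner : ℤ
    main  = sum (λ v → ⟦ cwᵇ x y v ⟧ * (e y v + e v x - + 3 * (e y v * e v x)))
    inner = sum (λ v → ⟦ cwᵇ x v y ⟧)
    move : ∀ a b c → a + b - c ≡ a - c + b
    move = solve-∀

  sum-between : ∀ x y → sum (λ v → ⟦ cwᵇ x v y ⟧) ≡ + d x y - 1ℤ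
  sum-between x y = sym (trans (cong (λ s → 1ℤ + s - 1ℤ) (Σv-sum {n} λ v → 𝟙 (cwᵇ x v y))) (cancel (sum λ v → ⟦ cwᵇ x v y ⟧)))
    where
    cancel : ∀ s → 1ℤ + s - 1ℤ ≡ s
    cancel = solve-∀

  sum-beyond : ∀ x y → sum (λ v → ⟦ cwᵇ x y v ⟧) ≡ + d y x - 1ℤ
  sum-beyond x y = trans (sum-cong-≗ {n} λ v → cong ⟦_⟧ (Cyc.c-rotate {n} x y v)) (sum-between y x)

  -- For indicators `p`, `q` the term `p + q - 3pq` equals `p + q` minus `3pq`, and also
  -- `3 - 2(p + q)` minus `3(1 - p)(1 - q)`. Both corrections are nonnegative, so each form bounds
  -- `gain` above by degrees, increasing in them in one case and decreasing in the other.
  joined missed : Fin n → Fin n → Fin n → ℤ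
  joined x y v = ⟦ cwᵇ x y v ⟧ * (e y v * e v x)
  missed x y v = ⟦ cwᵇ x y v ⟧ * ((1ℤ - e y v) * (1ℤ - e v x))

  joined-nonneg : ∀ x y → 0ℤ ≤ᶻ sum (joined x y)
  joined-nonneg x y = sum-nonneg λ v → nonneg (cwᵇ x y v) (edge G y v) (edge G v x)
    where
    nonneg : ∀ c e₁ e₂ → 0ℤ ≤ᶻ ⟦ c ⟧ * (⟦ e₁ ⟧ * ⟦ e₂ ⟧)
    nonneg true  true  true  = +≤+ z≤n
    nonneg true  true  false = +≤+ z≤n
    nonneg true  false _     = +≤+ z≤n
    nonneg false _     _     = +≤+ z≤n

  missed-nonneg : ∀ x y → 0ℤ ≤ᶻ sum (missed x y)
  missed-nonneg x y = sum-nonneg λ v → nonneg (cwᵇ x y v) (edge G y v) (edge G v x)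
    where
    nonneg : ∀ c e₁ e₂ → 0ℤ ≤ᶻ ⟦ c ⟧ * ((1ℤ - ⟦ e₁ ⟧) * (1ℤ - ⟦ e₂ ⟧))
    nonneg true  true  true  = +≤+ z≤n
    nonneg true  true  false = +≤+ z≤n
    nonneg true  false true  = +≤+ z≤n
    nonneg true  false false = +≤+ z≤n
    nonneg false _     _     = +≤+ z≤n

  module _ {x y : Fin n} (x≢y : x ≢ y) (¬yx : edge G y x ≡ false) where

    -- An edge from `y` reaching past `x` would contain `yx`. Hence sums over the arc beyond `xy`
    -- see the full out-degree of `y`, and likewise the full in-degree of `x`.
    out-beyond : ∀ {v} → edge G y v ≡ true → CW x y v
    out-beyond {v} yv with total x≢y (edge⇒≢ G yv) (λ { refl → true≢false yv ¬yx })
    ... | inj₁ xyv = xyv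
    ... | inj₂ vyx = ⊥-elim (true≢false (convexˡ (rotate vyx) yv) ¬yx)

    in-beyond : ∀ {v} → edge G v x ≡ true → CW x y v
    in-beyond {v} vx with total x≢y (λ { refl → true≢false vx ¬yx }) (edge⇒≢ G vx ∘ sym)
    ... | inj₁ xyv = xyv
    ... | inj₂ vyx = ⊥-elim (true≢false (convexʳ vyx vx) ¬yx)

    private
      absorb : ∀ {c e} → (e ≡ true → c ≡ true) → ⟦ c ⟧ * ⟦ e ⟧ ≡ ⟦ e ⟧
      absorb {true}  {true}  _ = refl
      absorb {true}  {false} _ = refl
      absorb {false} {true}  h with () ← h refl
      absorb {false} {false} _ = refl

      out-absorb : ∀ v → ⟦ cwᵇ x y v ⟧ * e y v ≡ e y v
      out-absorb v = absorb λ yv → holds (out-beyond yv)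

      in-absorb : ∀ v → ⟦ cwᵇ x y v ⟧ * e v x ≡ e v x
      in-absorb v = absorb λ vx → holds (in-beyond vx)

      degrees : sum (λ v → e y v + e v x) ≡ + outdeg y + + indeg x
      degrees = trans (∑-distrib-+ {n} _ _) (cong₂ _+_ (sym (Σv-sum {n} _)) (sym (Σv-sum {n} _)))

      add-scaled : ∀ (f g : Fin n → ℤ) → sum f + + 3 * sum g ≡ sum (λ v → f v + + 3 * g v)
      add-scaled f g = trans (cong (λ z → sum f + z) (sym (sum-scale {n} (+ 3) g))) (sym (∑-distrib-+ {n} _ _))

      f : Fin n → ℤ
      f v = ⟦ cwᵇ x y v ⟧ * (e y v + e v x - + 3 * (e y v * e v x))

      reorder : ∀ a b c → a - b + c ≡ a + c - b
      reorder = solve-∀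

    gain-joined : gain x y + + 3 * sum (joined x y) ≡ + outdeg y + + indeg x - (+ d x y - 1ℤ)
    gain-joined = begin
      gain x y + + 3 * sum (joined x y)
        ≡⟨ reorder (sum f) _ _ ⟩
      sum f + + 3 * sum (joined x y) - sum (λ v → ⟦ cwᵇ x v y ⟧)
        ≡⟨ cong₂ _-_ (add-scaled f (joined x y)) (sum-between x y) ⟩
      sum (λ v → f v + + 3 * joined x y v) - (+ d x y - 1ℤ)
        ≡⟨ cong (λ s → s - (+ d x y - 1ℤ)) (trans (sum-cong-≗ {n} λ v →
             trans (expand ⟦ cwᵇ x y v ⟧ (e y v) (e v x)) (cong₂ _+_ (out-absorb v) (in-absorb v))) degrees) ⟩
      + outdeg y + + indeg x - (+ d x y - 1ℤ) ∎
      where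
      open ≡-Reasoning
      expand : ∀ c a b → c * (a + b - + 3 * (a * b)) + + 3 * (c * (a * b)) ≡ c * a + c * b
      expand = solve-∀

    gain-missed : gain x y + + 3 * sum (missed x y) ≡
      + 3 * (+ n - + d x y - 1ℤ) - + 2 * (+ outdeg y + + indeg x) - (+ d x y - 1ℤ)
    gain-missed = begin
      gain x y + + 3 * sum (missed x y)
        ≡⟨ reorder (sum f) _ _ ⟩
      sum f + + 3 * sum (missed x y) - sum (λ v → ⟦ cwᵇ x v y ⟧)
        ≡⟨ cong₂ _-_ (add-scaled f (missed x y)) (sum-between x y) ⟩
      sum (λ v → f v + + 3 * missed x y v) - (+ d x y - 1ℤ)
        ≡⟨ cong (λ s → s - (+ d x y - 1ℤ)) (sum-cong-≗ {n} λ v →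
             trans (expand ⟦ cwᵇ x y v ⟧ (e y v) (e v x))
             (cong (λ s → + 3 * ⟦ cwᵇ x y v ⟧ + - + 2 * s) (cong₂ _+_ (out-absorb v) (in-absorb v)))) ⟩
      sum (λ v → + 3 * ⟦ cwᵇ x y v ⟧ + - + 2 * (e y v + e v x)) - (+ d x y - 1ℤ)
        ≡⟨ cong (λ s → s - (+ d x y - 1ℤ)) (trans (∑-distrib-+ {n} _ _)
             (cong₂ _+_ (trans (sum-scale {n} (+ 3) _) (cong (λ s → + 3 * s) (sum-beyond x y)))
               (trans (sum-scale {n} (- + 2) _) (cong (λ s → - + 2 * s) degrees)))) ⟩
      + 3 * (+ d y x - 1ℤ) + - + 2 * (+ outdeg y + + indeg x) - (+ d x y - 1ℤ)
        ≡⟨ cong (λ s → + 3 * (s - 1ℤ) + - + 2 * (+ outdeg y + + indeg x) - (+ d x y - 1ℤ)) d-yx ⟩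
      + 3 * (+ n - + d x y - 1ℤ) + - + 2 * (+ outdeg y + + indeg x) - (+ d x y - 1ℤ)
        ≡⟨ tidy (+ 3 * (+ n - + d x y - 1ℤ)) (+ outdeg y + + indeg x) (+ d x y - 1ℤ) ⟩
      + 3 * (+ n - + d x y - 1ℤ) - + 2 * (+ outdeg y + + indeg x) - (+ d x y - 1ℤ) ∎
      where
      open ≡-Reasoning
      expand : ∀ c a b → c * (a + b - + 3 * (a * b)) + + 3 * (c * ((1ℤ - a) * (1ℤ - b))) ≡
        + 3 * c + - + 2 * (c * a + c * b)
      expand = solve-∀
      tidy : ∀ a p b → a + - + 2 * p - b ≡ a - + 2 * p - b
      tidy = solve-∀
      d-yx : + d y x ≡ + n - + d x y
      d-yx = trans (cancel (+ d x y) (+ d y x)) (cong (λ s → + s - + d x y) (d-flip x≢y))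
        where
        cancel : ∀ a b → b ≡ a + b - a
        cancel = solve-∀

-- Optimality under moves

sum₂-pair : (x y : Fin n) (g : Fin n → Fin n → ℤ) →
            sum₂ (λ u w → ⟦ (u ≡ᶠ x) ∧ (w ≡ᶠ y) ⟧ * g u w) ≡ g x y
sum₂-pair {n} x y g = begin
  sum₂ (λ u w → ⟦ (u ≡ᶠ x) ∧ (w ≡ᶠ y) ⟧ * g u w)
    ≡⟨ (sum-cong-≗ {n} λ u → trans (sum-cong-≗ {n} λ w → unfold (u ≡ᶠ x) (w ≡ᶠ y) (g u w))
         (trans (sum-scale {n} ⟦ u ≡ᶠ x ⟧ _) (cong (λ s → ⟦ u ≡ᶠ x ⟧ * s) (sum-δ (g u) y)))) ⟩
  sum (λ u → ⟦ u ≡ᶠ x ⟧ * g u y)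
    ≡⟨ sum-δ (λ u → g u y) x ⟩
  g x y ∎
  where
  open ≡-Reasoning
  unfold : ∀ a b s → ⟦ a ∧ b ⟧ * s ≡ ⟦ a ⟧ * (⟦ b ⟧ * s)
  unfold true  b s = sym (ℤ.*-identityˡ _)
  unfold false b s = refl

sum₂-sub : (f g : Fin n → Fin n → ℤ) → sum₂ (λ u w → f u w - g u w) ≡ sum₂ f - sum₂ g
sum₂-sub {n} f g = trans (sum-cong-≗ {n} λ u → sum-sub (f u) (g u)) (sum-sub {n} _ _)

none : Fin n → Fin n → Bool
none _ _ = false

pair : Fin n → Fin n → Fin n → Fin n → Bool
pair x y u v = (u ≡ᶠ x) ∧ (v ≡ᶠ y)

pair-self : (x y : Fin n) → pair x y x y ≡ true
pair-self x y = cong₂ _∧_ (≡ᶠ-refl x) (≡ᶠ-refl y)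

pair⁻ : (x y u v : Fin n) → pair x y u v ≡ true → u ≡ x × v ≡ y
pair⁻ x y u v h = Product.map ≡ᶠ-true⇒≡ ≡ᶠ-true⇒≡ (∧-true⁻ h)

pair-≢₁ : {x u : Fin n} (y v : Fin n) → u ≢ x → pair x y u v ≡ false
pair-≢₁ y v u≢x = cong (λ b → b ∧ (v ≡ᶠ y)) (≢⇒≡ᶠ-false u≢x)

pair-≢₂ : {y v : Fin n} (x u : Fin n) → v ≢ y → pair x y u v ≡ false
pair-≢₂ x u v≢y = trans (cong ((u ≡ᶠ x) ∧_) (≢⇒≡ᶠ-false v≢y)) (Bool.∧-zeroʳ (u ≡ᶠ x))

module OptimalMoves {n} (G : Digraph n) (opt : Optimal n G) {a b : ℕ} (ext : Extremal G a b) where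

  adm : Admissible G
  adm = proj₁ opt

  open Admissible
  open Gain G adm

  signed : (A B : Fin n → Fin n → Bool) → Fin n → Fin n → ℤ
  signed A B u v = ⟦ A u v ⟧ - ⟦ B u v ⟧

  change : (A B : Fin n → Fin n → Bool) → ℤ
  change A B = sum₂ λ u w → signed A B u w * slope (weight G) (signed A B) u w

  module _ {A B : Fin n → Fin n → Bool} (move : Move G a b A B) where

    open Perturbation G adm ext move

    P̃₃-change : + P̃₃ H ≡ + P̃₃ G + change A B
    P̃₃-change = begin
      + P̃₃ H                                  ≡⟨ P̃₃≡paths H H-admissible ⟩
      paths (weight H)                        ≡⟨ paths-cong weight-H ⟩
      paths (λ u v → weight G u v + signed A B u v) ≡⟨ paths-expand (weight G) (signed A B) ⟩
      paths (weight G) + change A B           ≡⟨ cong (λ z → z + change A B) (sym (P̃₃≡paths G adm)) ⟩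
      + P̃₃ G + change A B                     ∎
      where open ≡-Reasoning

    change-≤ : 0ℤ ≤ᶻ - change A B
    change-≤ = 0≤-≡ (≤⇒0≤ (proj₁ (proj₂ opt) H H-admissible))
      (trans (cong (λ z → + P̃₃ G - z) P̃₃-change) (cancel (+ P̃₃ G) (change A B)))
      where
      cancel : ∀ p c → p - (p + c) ≡ - c
      cancel = solve-∀

    -- The move lowers `ξ`, so a tie in `P̃₃` would contradict the second criterion of optimality;
    -- the loss is therefore at least 1.
    change-< : (∀ {u v} → B u v ≡ true → b ℕ.+ b ≤ n) →
      ∀ {u v w x} → edge G u v ≡ true → d u v ≡ b → NonEdge G w x → d w x ≡ a →
      (A w x ≡ true ⊎ B u v ≡ true) → 0ℤ ≤ᶻ - change A B - 1ℤ
    change-< 2b≤n uv duv ¬wx dwx A⊎B = 0≤-≡ (≤⇒0≤ fewer)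
      (trans (cong (λ z → + P̃₃ G - (1ℤ + z)) P̃₃-change) (cancel (+ P̃₃ G) (change A B)))
      where
      fewer : P̃₃ H < P̃₃ G
      fewer = ℕ.≤∧≢⇒< (proj₁ (proj₂ opt) H H-admissible) λ same →
        ℕ.<⇒≱ (ξ-decreases 2b≤n uv duv ¬wx dwx A⊎B) (proj₂ (proj₂ opt) H H-admissible same)
      cancel : ∀ p c → p - (1ℤ + (p + c)) ≡ - c - 1ℤ
      cancel = solve-∀

  interaction-zero : ∀ h x y → (∀ v → h y v ≡ 0ℤ) → interaction h x y ≡ 0ℤ
  interaction-zero h x y h≗0 = sum-zero λ v → trans
    (cong (λ z → ⟦ cwᵇ x y v ⟧ * (z * (1ℤ - + 3 * weight G v x - h v x))) (h≗0 v)) (ℤ.*-zeroʳ ⟦ cwᵇ x y v ⟧)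

  -- The factor is `1 - 3`: the changed pairs `xy` and `yv` are closed to a directed triangle by the
  -- unchanged edge `vx`.
  interaction-single : ∀ h {x y v} → CW x y v → edge G v x ≡ true → h v x ≡ 0ℤ →
    (∀ t → t ≢ v → h y t ≡ 0ℤ) → interaction h x y ≡ - + 2 * h y v
  interaction-single h {x} {y} {v} xyv vx hvx h≗0 = begin
    interaction h x y
      ≡⟨ sum-single v (λ t t≢v → trans
           (cong (λ z → ⟦ cwᵇ x y t ⟧ * (z * (1ℤ - + 3 * weight G t x - h t x))) (h≗0 t t≢v))
           (ℤ.*-zeroʳ ⟦ cwᵇ x y t ⟧)) ⟩
    ⟦ cwᵇ x y v ⟧ * (h y v * (1ℤ - + 3 * weight G v x - h v x))
      ≡⟨ cong₂ (λ c e → ⟦ c ⟧ * (h y v * (1ℤ - + 3 * ⟦ e ⟧ - h v x))) (holds xyv) vx ⟩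
    1ℤ * (h y v * (1ℤ - + 3 * 1ℤ - h v x))
      ≡⟨ cong (λ z → 1ℤ * (h y v * (1ℤ - + 3 * 1ℤ - z))) hvx ⟩
    1ℤ * (h y v * (1ℤ - + 3 * 1ℤ - 0ℤ))
      ≡⟨ evaluate (h y v) ⟩
    - + 2 * h y v ∎
    where
    open ≡-Reasoning
    evaluate : ∀ z → 1ℤ * (z * (1ℤ - + 3 * 1ℤ - 0ℤ)) ≡ - + 2 * z
    evaluate = solve-∀

  -- The strict form would require `b + b ≤ n`, which is itself deduced from this inequality. For an
  -- insertion nothing is deleted, so that condition holds vacuously.
  deletion : ∀ {u v} → edge G u v ≡ true → d u v ≡ b → 0ℤ ≤ᶻ gain u v
  deletion {u} {v} uv duv = 0≤-≡ (change-≤ move) effect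
    where
    move : Move G a b none (pair u v)
    move = record
      { A-shortest = λ ()
      ; B-longest  = λ {x} {y} h → case (pair⁻ u v x y h)
      ; A-asym     = λ ()
      }
      where
      case : ∀ {x y} → x ≡ u × y ≡ v → edge G x y ≡ true × d x y ≡ b
      case (refl , refl) = uv , duv
    h = signed none (pair u v)
    effect : - change none (pair u v) ≡ gain u v
    effect = begin
      - sum₂ (λ x y → (0ℤ - ⟦ pair u v x y ⟧) * slope (weight G) h x y)
        ≡⟨ cong -_ (sum-cong-≗ {n} λ x → sum-cong-≗ {n} λ y → negate ⟦ pair u v x y ⟧ _) ⟩
      - sum₂ (λ x y → ⟦ pair u v x y ⟧ * (- slope (weight G) h x y))
        ≡⟨ cong -_ (sum₂-pair u v λ x y → - slope (weight G) h x y) ⟩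
      - - slope (weight G) h u v
        ≡⟨ ℤ.neg-involutive _ ⟩
      slope (weight G) h u v
        ≡⟨ slope-split h u v ⟩
      gain u v + interaction h u v
        ≡⟨ cong (λ z → gain u v + z) (interaction-zero h u v λ t →
             cong (λ c → 0ℤ - ⟦ c ⟧) (pair-≢₁ v t (edge⇒≢ G uv ∘ sym))) ⟩
      gain u v + 0ℤ
        ≡⟨ ℤ.+-identityʳ _ ⟩
      gain u v ∎
      where
      open ≡-Reasoning
      negate : ∀ p s → (0ℤ - p) * s ≡ p * (- s)
      negate = solve-∀

  module _ {x y} (¬xy : NonEdge G x y) (dxy : d x y ≡ a) {u v} (uv : edge G u v ≡ true) (duv : d u v ≡ b) where

    private
      added : ∀ s t → pair x y s t ≡ true → NonEdge G s t × d s t ≡ a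
      added s t h with refl , refl ← pair⁻ x y s t h = ¬xy , dxy

      removed : ∀ s t → pair u v s t ≡ true → edge G s t ≡ true × d s t ≡ b
      removed s t h with refl , refl ← pair⁻ u v s t h = uv , duv

      added-asym : ∀ s t → pair x y s t ≡ true → pair x y t s ≡ true → ⊥
      added-asym s t h k with refl , refl ← pair⁻ x y s t h = distinct ¬xy (sym (proj₁ (pair⁻ x y t s k)))

    insertion : 0ℤ ≤ᶻ - 1ℤ - gain x y
    insertion = 0≤-≡ (change-< move (λ ()) uv duv ¬xy dxy (inj₁ (pair-self x y))) (trans (cong (λ z → - z - 1ℤ) effect) (flip (gain x y)))
      where
      move : Move G a b (pair x y) none
      move = record { A-shortest = added _ _ ; B-longest = λ () ; A-asym = λ {s} {t} → added-asym s t }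
      h = signed (pair x y) none
      flip : ∀ z → - z - 1ℤ ≡ - 1ℤ - z
      flip = solve-∀
      effect : change (pair x y) none ≡ gain x y
      effect = begin
        sum₂ (λ s t → (⟦ pair x y s t ⟧ - 0ℤ) * slope (weight G) h s t)
          ≡⟨ (sum-cong-≗ {n} λ s → sum-cong-≗ {n} λ t →
               cong (λ z → z * slope (weight G) h s t) (ℤ.+-identityʳ ⟦ pair x y s t ⟧)) ⟩
        sum₂ (λ s t → ⟦ pair x y s t ⟧ * slope (weight G) h s t)
          ≡⟨ sum₂-pair x y _ ⟩
        slope (weight G) h x y
          ≡⟨ slope-split h x y ⟩
        gain x y + interaction h x y
          ≡⟨ cong (λ z → gain x y + z) (interaction-zero h x y λ t →
               cong (λ c → ⟦ c ⟧ - 0ℤ) (pair-≢₁ y t (distinct ¬xy ∘ sym))) ⟩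
        gain x y + 0ℤ
          ≡⟨ ℤ.+-identityʳ _ ⟩
        gain x y ∎
        where open ≡-Reasoning

    module _ (2b≤n : b ℕ.+ b ≤ n) where

      private
        h : Fin n → Fin n → ℤ
        h = signed (pair x y) (pair u v)

        exchange-slopes : 0ℤ ≤ᶻ - (slope (weight G) h x y - slope (weight G) h u v) - 1ℤ
        exchange-slopes = 0≤-≡ (change-< move (λ _ → 2b≤n) uv duv ¬xy dxy (inj₁ (pair-self x y)))
          (cong (λ z → - z - 1ℤ) effect)
          where
          move : Move G a b (pair x y) (pair u v)
          move = record { A-shortest = added _ _ ; B-longest = removed _ _ ; A-asym = λ {s} {t} → added-asym s t }
          open ≡-Reasoning
          distrib : ∀ p q s → (p - q) * s ≡ p * s - q * s
          distrib = solve-∀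
          effect : change (pair x y) (pair u v) ≡ slope (weight G) h x y - slope (weight G) h u v
          effect = begin
            change (pair x y) (pair u v)
              ≡⟨ (sum-cong-≗ {n} λ s → sum-cong-≗ {n} λ t → distrib ⟦ pair x y s t ⟧ ⟦ pair u v s t ⟧ _) ⟩
            sum₂ (λ s t → ⟦ pair x y s t ⟧ * slope (weight G) h s t - ⟦ pair u v s t ⟧ * slope (weight G) h s t)
              ≡⟨ sum₂-sub {n} _ _ ⟩
            sum₂ (λ s t → ⟦ pair x y s t ⟧ * slope (weight G) h s t)
              - sum₂ (λ s t → ⟦ pair u v s t ⟧ * slope (weight G) h s t)
              ≡⟨ cong₂ _-_ (sum₂-pair x y _) (sum₂-pair u v _) ⟩
            slope (weight G) h x y - slope (weight G) h u v ∎

        conclude : ∀ {i j} → interaction h x y ≡ i → interaction h u v ≡ j → i - j ≡ + 2 →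
                   0ℤ ≤ᶻ gain u v - gain x y - + 3
        conclude {i} {j} refl refl i-j = 0≤-≡ exchange-slopes (begin
          - (slope (weight G) h x y - slope (weight G) h u v) - 1ℤ
            ≡⟨ cong₂ (λ s t → - (s - t) - 1ℤ) (slope-split h x y) (slope-split h u v) ⟩
          - (gain x y + i - (gain u v + j)) - 1ℤ
            ≡⟨ regroup (gain x y) i (gain u v) j ⟩
          gain u v - gain x y - (i - j) - 1ℤ
            ≡⟨ cong (λ z → gain u v - gain x y - z - 1ℤ) i-j ⟩
          gain u v - gain x y - + 2 - 1ℤ
            ≡⟨ numeral (gain u v - gain x y) ⟩
          gain u v - gain x y - + 3 ∎)
          where
          open ≡-Reasoning
          regroup : ∀ p i q j → - (p + i - (q + j)) - 1ℤ ≡ q - p - (i - j) - 1ℤ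
          regroup = solve-∀
          numeral : ∀ z → z - + 2 - 1ℤ ≡ z - + 3
          numeral = solve-∀

        h-zero : ∀ s t → pair x y s t ≡ false → pair u v s t ≡ false → h s t ≡ 0ℤ
        h-zero s t p q = cong₂ (λ i j → ⟦ i ⟧ - ⟦ j ⟧) p q

      -- Of the 3, one unit comes from `ξ` and two from the junction at `y`, where an inserted pair
      -- is followed by a deleted one.
      exchange-after : u ≡ y → CW x y v → edge G v x ≡ true → 0ℤ ≤ᶻ gain u v - gain x y - + 3
      exchange-after refl xyv vx = conclude
        (trans (interaction-single h xyv vx
          (h-zero v x (pair-≢₁ y x v≢x) (pair-≢₁ v x v≢y))
          (λ t t≢v → h-zero y t (pair-≢₁ y t y≢x) (pair-≢₂ y y t≢v)))
          (cong (λ z → - + 2 * z) (cong₂ (λ i j → ⟦ i ⟧ - ⟦ j ⟧) (pair-≢₁ y v y≢x) (pair-self y v))))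
        (interaction-zero h y v λ t → h-zero v t (pair-≢₁ y t v≢x) (pair-≢₁ v t v≢y))
        refl
        where
        v≢x = edge⇒≢ G vx
        v≢y = edge⇒≢ G uv ∘ sym
        y≢x = distinct ¬xy ∘ sym

      -- Now the junction is at `x`, and its interaction is charged to the deleted edge, the first
      -- of the two pairs. It is -2 there and enters with a minus sign.
      exchange-before : v ≡ x → CW u x y → edge G y u ≡ true → 0ℤ ≤ᶻ gain u v - gain x y - + 3
      exchange-before refl uxy yu = conclude
        (interaction-zero h x y λ t → h-zero y t (pair-≢₁ y t y≢x) (pair-≢₁ x t y≢u))
        (trans (interaction-single h uxy yu
          (h-zero y u (pair-≢₁ y u y≢x) (pair-≢₁ x u y≢u))
          (λ t t≢y → h-zero x t (pair-≢₂ x x t≢y) (pair-≢₁ x t x≢u)))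
          (cong (λ z → - + 2 * z) (cong₂ (λ i j → ⟦ i ⟧ - ⟦ j ⟧) (pair-self x y) (pair-≢₁ x y x≢u))))
        refl
        where
        y≢x = distinct ¬xy ∘ sym
        y≢u = edge⇒≢ G yu
        x≢u = edge⇒≢ G uv ∘ sym

-- Degrees at the ends of longest edges and shortest non-edges

order₄ : {y w v x : Fin n} → CW y v x → CW y w v → CW w v x
order₄ yvx ywv = rotate (rotate (chain (rotate yvx) (rotate (rotate ywv))))

d-injective : {y v w : Fin n} → y ≢ v → y ≢ w → d y v ≡ d y w → v ≡ w
d-injective {v = v} {w} y≢v y≢w same with v ≟ w
... | yes v≡w = v≡w
... | no v≢w with total y≢v v≢w y≢w
...   | inj₁ yvw = ⊥-elim (ℕ.<⇒≢ (d-mono-< yvw) same)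
...   | inj₂ wvy = ⊥-elim (ℕ.<⇒≢ (d-mono-< (rotate (rotate wvy))) (sym same))

d-injectiveʳ : {y v w : Fin n} → v ≢ y → w ≢ y → d v y ≡ d w y → v ≡ w
d-injectiveʳ {y = y} {v} {w} v≢y w≢y same with v ≟ w
... | yes v≡w = v≡w
... | no v≢w with total v≢w w≢y v≢y
...   | inj₁ vwy = ⊥-elim (ℕ.<⇒≢ (d-mono-<ʳ vwy) (sym same))
...   | inj₂ ywv = ⊥-elim (ℕ.<⇒≢ (d-mono-<ʳ (rotate ywv)) same)

d<⇒CW : {y w v : Fin n} → y ≢ w → y ≢ v → d y w < d y v → CW y w v
d<⇒CW y≢w y≢v yw<yv with total y≢w (λ { refl → ℕ.<-irrefl refl yw<yv }) y≢v
... | inj₁ ywv = ywv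
... | inj₂ vwy = ⊥-elim (ℕ.<-asym yw<yv (d-mono-< (rotate (rotate vwy))))

record Longest {n} (G : Digraph n) (b : ℕ) (u v : Fin n) : Set where
  constructor longest
  field
    isEdge : edge G u v ≡ true
    len    : d u v ≡ b

record Shortest {n} (G : Digraph n) (a : ℕ) (x y : Fin n) : Set where
  constructor shortest
  field
    isNonEdge : NonEdge G x y
    len       : d x y ≡ a

module Degrees {n} (3≤n : 3 ≤ n) (G : Digraph n) (opt : Optimal n G) {a b : ℕ} (ext : Extremal G a b)
  {x₀ y₀ u₀ v₀ : Fin n} (sh₀ : Shortest G a x₀ y₀) (lo₀ : Longest G b u₀ v₀) where

  open OptimalMoves G opt ext public
  open Gain G adm public
  open Admissible G adm using (2free; convexˡ; convexʳ) public
  open Extremal ext public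
  open Longest public
  open Shortest public

  1≤a : 1 ≤ a
  1≤a = subst (1 ≤_) (len sh₀) (s≤s z≤n)

  -- Otherwise the arc behind a longest edge `uv` is shorter than `a`. Every vertex `w` on it then
  -- forms a directed triangle with `uv`, since `vw` and `wu` are too short for non-edges and their
  -- reverses too long for edges. Deleting `uv` would gain `n - 2`.
  a+b≤n : a ℕ.+ b ≤ n
  a+b≤n with a ℕ.+ b ℕ.≤? n
  ... | yes a+b≤n = a+b≤n
  ... | no a+b≰n = ⊥-elim (-1-negative
      (0≤+ (0≤-≡ (deletion (isEdge lo₀) (len lo₀)) gain-value) (≤⇒0≤ 3≤n)) (final (+ n)))
    where
    u = u₀
    v = v₀
    uv = isEdge lo₀
    flip-uv : d u v ℕ.+ d v u ≡ n
    flip-uv = d-flip (edge⇒≢ G uv)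
    short : d v u < a
    short = ℕ.+-cancelʳ-< b (d v u) a (subst (_< a ℕ.+ b)
      (trans (sym flip-uv) (trans (ℕ.+-comm (d u v) (d v u)) (cong (d v u ℕ.+_) (len lo₀)))) (ℕ.≰⇒> a+b≰n))

    joins : ∀ {w} → CW u v w → edge G v w ≡ true × edge G w u ≡ true
    joins {w} uvw = vw , wu
      where
      vw : edge G v w ≡ true
      vw with cases G (distinct₂₃ uvw)
      ... | inj₁ vw = vw
      ... | inj₂ (inj₁ wv) = ⊥-elim (ℕ.<⇒≱ (d-mono-<ʳ (rotate (rotate uvw)))
              (ℕ.≤-trans (edge≤b wv) (ℕ.≤-reflexive (sym (len lo₀)))))
      ... | inj₂ (inj₂ ¬vw) = ⊥-elim (ℕ.<⇒≱ (ℕ.<-trans (d-mono-< (rotate uvw)) short) (a≤nonEdge ¬vw))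
      wu : edge G w u ≡ true
      wu with cases G (distinct₂₃ (rotate uvw))
      ... | inj₁ wu = wu
      ... | inj₂ (inj₁ uw) = ⊥-elim (ℕ.<⇒≱ (d-mono-< uvw)
              (ℕ.≤-trans (edge≤b uw) (ℕ.≤-reflexive (sym (len lo₀)))))
      ... | inj₂ (inj₂ ¬wu) = ⊥-elim (ℕ.<⇒≱ (ℕ.<-trans (d-mono-<ʳ (rotate uvw)) short) (a≤nonEdge ¬wu))

    open ≡-Reasoning
    term : ∀ {c e₁ e₂} → (c ≡ true → e₁ ≡ true × e₂ ≡ true) →
      ⟦ c ⟧ * (⟦ e₁ ⟧ + ⟦ e₂ ⟧ - + 3 * (⟦ e₁ ⟧ * ⟦ e₂ ⟧)) ≡ - 1ℤ * ⟦ c ⟧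
    term {true} h with refl , refl ← h refl = refl
    term {false} h = refl
    sum-up : ∀ x y → - 1ℤ * (x - 1ℤ) - (y - 1ℤ) ≡ + 2 - (y + x)
    sum-up = solve-∀
    gain-value : gain u v ≡ + 2 - + n
    gain-value = begin
      gain u v
        ≡⟨ cong₂ _-_ (trans (sum-cong-≗ {n} λ w → term λ uvw → joins (cw uvw)) (sum-scale {n} (- 1ℤ) _)) (sum-between u v) ⟩
      - 1ℤ * sum (λ w → ⟦ cwᵇ u v w ⟧) - (+ d u v - 1ℤ)
        ≡⟨ cong (λ s → - 1ℤ * s - (+ d u v - 1ℤ)) (sum-beyond u v) ⟩
      - 1ℤ * (+ d v u - 1ℤ) - (+ d u v - 1ℤ)
        ≡⟨ sum-up (+ d v u) (+ d u v) ⟩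
      + 2 - + (d u v ℕ.+ d v u)
        ≡⟨ cong (λ k → + 2 - + k) flip-uv ⟩
      + 2 - + n ∎
    final : ∀ N → + 2 - N + (N - + 3) ≡ - 1ℤ
    final = solve-∀

  -- The case to worry about is an edge `mv`; its length is at most `b`, which leaves at least
  -- `n - b ≥ a` for `vm`.
  far : ∀ {v m} → v ≢ m → edge G v m ≡ false → a ≤ d v m
  far {v} {m} v≢m ¬vm with cases G v≢m
  ... | inj₁ vm = ⊥-elim (true≢false vm ¬vm)
  ... | inj₂ (inj₂ nvm) = a≤nonEdge nvm
  ... | inj₂ (inj₁ mv) = ℕ.+-cancelʳ-≤ b a (d v m) (ℕ.≤-trans a+b≤n
          (ℕ.≤-trans (ℕ.≤-reflexive (sym (d-flip v≢m))) (ℕ.+-monoʳ-≤ (d v m) (edge≤b mv))))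

  outdeg≥ : ∀ {v x} → v ≢ x → edge G v x ≡ false → a ≤ ℕ.suc (outdeg v)
  outdeg≥ v≢x ¬vx with first-non-out v≢x ¬vx
  ... | m , v≢m , ¬vm , deg = ℕ.≤-trans (far v≢m ¬vm) (ℕ.≤-reflexive (sym deg))

  indeg≥ : ∀ {u x} → u ≢ x → edge G x u ≡ false → a ≤ ℕ.suc (indeg u)
  indeg≥ u≢x ¬xu with last-non-in u≢x ¬xu
  ... | m , u≢m , ¬mu , deg = ℕ.≤-trans (far (u≢m ∘ sym) ¬mu) (ℕ.≤-reflexive (sym deg))

  outdeg≤ : ∀ {u v} → edge G u v ≡ true → outdeg u ≤ b
  outdeg≤ uv with last-out uv
  ... | w , uw , deg = ℕ.≤-trans (ℕ.≤-reflexive deg) (edge≤b uw)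

  indeg≤ : ∀ {u v} → edge G v u ≡ true → indeg u ≤ b
  indeg≤ {u} {v} vu with first-in {u} {v} vu
  ... | w , wu , deg = ℕ.≤-trans (ℕ.≤-reflexive deg) (edge≤b wu)

  module OfShortest {x y} (sh : Shortest G a x y) where

    ¬xy = isNonEdge sh
    x≢y = distinct ¬xy
    ¬yx = ¬back ¬xy

    insertion-loses : 0ℤ ≤ᶻ - 1ℤ - gain x y
    insertion-loses = insertion ¬xy (len sh) (isEdge lo₀) (len lo₀)

    -- Without such a vertex the `joined` form of `gain` is exact, and both degrees are at least
    -- `a - 1`, so inserting `xy` would gain at least `a - 1 ≥ 0`.
    closing : ∃ λ w → edge G y w ≡ true × edge G w x ≡ true
    closing with any? (λ w → (edge G y w Bool.≟ true) ×-dec (edge G w x Bool.≟ true))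
    ... | yes found = found
    ... | no none-joined = ⊥-elim (-1-negative
        (0≤+ insertion-loses (0≤+ (≤⇒0≤ (outdeg≥ (x≢y ∘ sym) ¬yx)) (0≤+ (≤⇒0≤ (indeg≥ x≢y ¬yx)) (≤⇒0≤ 1≤a))))
        (trans (cong (λ g → - 1ℤ - g + (1ℤ + + outdeg y - + a + (1ℤ + + indeg x - + a + (+ a - 1ℤ)))) gain-value) (identity (+ outdeg y) (+ indeg x) (+ a))))
      where
      term : ∀ {c e₁ e₂} → ¬ (e₁ ≡ true × e₂ ≡ true) → ⟦ c ⟧ * (⟦ e₁ ⟧ * ⟦ e₂ ⟧) ≡ 0ℤ
      term {c} {true} {true}  h = ⊥-elim (h (refl , refl))
      term {c} {true} {false} h = ℤ.*-zeroʳ ⟦ c ⟧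
      term {c} {false}        h = ℤ.*-zeroʳ ⟦ c ⟧
      no-joined : sum (joined x y) ≡ 0ℤ
      no-joined = sum-zero {n} λ w → term {cwᵇ x y w} λ yw-wx → none-joined (w , yw-wx)
      gain-value : gain x y ≡ + outdeg y + + indeg x - (+ a - 1ℤ)
      gain-value = trans (sym (trans (cong (λ s → gain x y + + 3 * s) no-joined) (ℤ.+-identityʳ _)))
        (trans (gain-joined x≢y ¬yx) (cong (λ k → + outdeg y + + indeg x - (+ k - 1ℤ)) (len sh)))
      identity : ∀ p q α → - 1ℤ - (p + q - (α - 1ℤ)) + (1ℤ + p - α + (1ℤ + q - α + (α - 1ℤ))) ≡ - 1ℤ
      identity = solve-∀

    -- One closing vertex w forces every vertex of (y , x) before w to be an out-neighbour of y and
    -- every later one to be an in-neighbour of x.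
    gain-shortest : gain x y ≡ + 3 * (+ n - + a - 1ℤ) - + 2 * (+ outdeg y + + indeg x) - (+ a - 1ℤ)
    gain-shortest = trans (sym (trans (cong (λ s → gain x y + + 3 * s) no-missed) (ℤ.+-identityʳ _)))
        (trans (gain-missed x≢y ¬yx)
          (cong (λ k → + 3 * (+ n - + k - 1ℤ) - + 2 * (+ outdeg y + + indeg x) - (+ k - 1ℤ)) (len sh)))
      where
      w = proj₁ closing
      yw = proj₁ (proj₂ closing)
      wx = proj₂ (proj₂ closing)
      covered : ∀ {v} → CW x y v → edge G y v ≡ true ⊎ edge G v x ≡ true
      covered {v} xyv with v ≟ w
      ... | yes refl = inj₁ yw
      ... | no v≢w with total (distinct₂₃ xyv) v≢w (edge⇒≢ G yw)
      ...   | inj₁ yvw = inj₁ (convexˡ yvw yw)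
      ...   | inj₂ wvy = inj₂ (convexʳ (order₄ (rotate xyv) (rotate (rotate wvy))) wx)
      term : ∀ {c e₁ e₂} → (c ≡ true → e₁ ≡ true ⊎ e₂ ≡ true) → ⟦ c ⟧ * ((1ℤ - ⟦ e₁ ⟧) * (1ℤ - ⟦ e₂ ⟧)) ≡ 0ℤ
      term {false} h = refl
      term {true} {e₁} {e₂} h with h refl
      ... | inj₁ refl = refl
      ... | inj₂ refl = cong (λ z → 1ℤ * z) (ℤ.*-zeroʳ (1ℤ - ⟦ e₁ ⟧))
      no-missed : sum (missed x y) ≡ 0ℤ
      no-missed = sum-zero {n} λ v → term λ xyv → covered (cw xyv)

    out≤ : outdeg y ≤ b
    out≤ = outdeg≤ (proj₁ (proj₂ closing))

    in≤ : indeg x ≤ b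
    in≤ = indeg≤ {x} (proj₂ (proj₂ closing))

  module OfLongest {u v} (lo : Longest G b u v) where

    u≢v = edge⇒≢ G (isEdge lo)
    ¬vu = 2free (isEdge lo)

    out≥ : a ≤ ℕ.suc (outdeg v)
    out≥ = outdeg≥ (u≢v ∘ sym) ¬vu

    in≥ : a ≤ ℕ.suc (indeg u)
    in≥ = indeg≥ u≢v ¬vu

    cap : ℤ
    cap = + 3 * (+ n - + b - 1ℤ) - + 2 * (+ outdeg v + + indeg u) - (+ b - 1ℤ)

    gain-longest : gain u v + + 3 * sum (missed u v) ≡ cap
    gain-longest = trans (gain-missed u≢v ¬vu)
      (cong (λ k → + 3 * (+ n - + k - 1ℤ) - + 2 * (+ outdeg v + + indeg u) - (+ k - 1ℤ)) (len lo))

    gain≤cap : 0ℤ ≤ᶻ cap - gain u v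
    gain≤cap = 0≤-≡ (0≤* 3 (missed-nonneg u v))
      (trans (cancel (gain u v) _) (cong (λ z → z - gain u v) gain-longest))
      where
      cancel : ∀ g z → z ≡ g + z - g
      cancel = solve-∀

    0≤cap : 0ℤ ≤ᶻ cap
    0≤cap = 0≤-≡ (0≤+ (deletion (isEdge lo) (len lo)) (0≤* 3 (missed-nonneg u v))) gain-longest

    0≤excess : 0ℤ ≤ᶻ + outdeg v + + indeg u - (+ b - 1ℤ)
    0≤excess = 0≤-≡ (0≤+ (deletion (isEdge lo) (len lo)) (0≤* 3 (joined-nonneg u v)))
      (trans (gain-joined u≢v ¬vu) (cong (λ k → + outdeg v + + indeg u - (+ k - 1ℤ)) (len lo)))

  module _ {x y u v} (sh : Shortest G a x y) (lo : Longest G b u v) where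

    private
      module S = OfShortest sh
      module L = OfLongest lo

      hP : 0ℤ ≤ᶻ + outdeg v + + indeg u - + 2 * (+ a - 1ℤ)
      hP = 0≤-≡ (0≤+ (≤⇒0≤ L.out≥) (≤⇒0≤ L.in≥)) (identity (+ a) (+ outdeg v) (+ indeg u))
        where
        identity : ∀ α p q → 1ℤ + p - α + (1ℤ + q - α) ≡ p + q - + 2 * (α - 1ℤ)
        identity = solve-∀

      hP′ : 0ℤ ≤ᶻ + 2 * + b - (+ outdeg y + + indeg x)
      hP′ = 0≤-≡ (0≤+ (≤⇒0≤ S.out≤) (≤⇒0≤ S.in≤)) (identity (+ b) (+ outdeg y) (+ indeg x))
        where
        identity : ∀ β p q → β - p + (β - q) ≡ + 2 * β - (p + q)
        identity = solve-∀

      module B = Bounds {+ n} {+ a} {+ b} {+ outdeg v + + indeg u} {+ outdeg y + + indeg x}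
        L.0≤cap L.0≤excess
        (0≤-≡ S.insertion-loses (cong (λ g → - 1ℤ - g) S.gain-shortest)) hP hP′

    pair-2b≤n : b ℕ.+ b ≤ n
    pair-2b≤n = 0≤⇒≤ B.2β≤N

    pair-a+b<n : a ℕ.+ b < n
    pair-a+b<n = 0≤⇒≤ (B.α+β<N (≤⇒0≤ 3≤n))

    -- By `degree-gap` the degree bounds have at most one unit of slack in total, so they cannot
    -- fail to be attained at both ends.
    end-maximal : outdeg y ≡ b ⊎ indeg x ≡ b
    end-maximal with outdeg y ℕ.≟ b | indeg x ℕ.≟ b
    ... | yes out | _      = inj₁ out
    ... | no _    | yes in′ = inj₂ in′
    ... | no out≢b | no in≢b = ⊥-elim (B.P′-nearly-maximal (0≤-≡
      (0≤+ (≤⇒0≤ (ℕ.≤∧≢⇒< S.out≤ out≢b)) (≤⇒0≤ (ℕ.≤∧≢⇒< S.in≤ in≢b)))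
      (identity (+ b) (+ outdeg y) (+ indeg x))))
      where
      identity : ∀ β p q → β - (1ℤ + p) + (β - (1ℤ + q)) ≡ + 2 * (β - 1ℤ) - (p + q)
      identity = solve-∀

    end-minimal : ℕ.suc (outdeg v) ≡ a ⊎ ℕ.suc (indeg u) ≡ a
    end-minimal with a ℕ.≟ ℕ.suc (outdeg v) | a ℕ.≟ ℕ.suc (indeg u)
    ... | yes out | _      = inj₁ (sym out)
    ... | no _    | yes in′ = inj₂ (sym in′)
    ... | no out≢ | no in≢ = ⊥-elim (B.P-nearly-minimal (0≤-≡
      (0≤+ (≤⇒0≤ (ℕ.s≤s⁻¹ (ℕ.≤∧≢⇒< L.out≥ out≢))) (≤⇒0≤ (ℕ.s≤s⁻¹ (ℕ.≤∧≢⇒< L.in≥ in≢))))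
      (identity (+ a) (+ outdeg v) (+ indeg u))))
      where
      identity : ∀ α p q → p - α + (q - α) ≡ p + q - + 2 * α
      identity = solve-∀

    record Tight : Set where
      field
        out-max : outdeg y ≡ b
        in-max  : indeg x ≡ b
        out-min : ℕ.suc (outdeg v) ≡ a
        in-min  : ℕ.suc (indeg u) ≡ a

    exchange-loses⇒tight : 0ℤ ≤ᶻ gain u v - gain x y - + 3 → Tight
    exchange-loses⇒tight loses = record
      { out-max = ℕ.≤-antisym S.out≤ (0≤⇒≤ T.p′≥)
      ; in-max  = ℕ.≤-antisym S.in≤ (0≤⇒≤ T.q′≥)
      ; out-min = ℕ.≤-antisym (0≤⇒≤ T.p≤) L.out≥
      ; in-min  = ℕ.≤-antisym (0≤⇒≤ T.q≤) L.in≥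
      }
      where
      identity : ∀ c g g′ → c - g + (g - g′ - + 3) ≡ c - g′ - + 3
      identity = solve-∀
      module T = Tightness {+ n} {+ a} {+ b} {+ outdeg v} {+ indeg u} {+ outdeg y} {+ indeg x}
        (0≤-≡ (0≤+ L.gain≤cap loses)
          (trans (identity L.cap (gain u v) (gain x y)) (cong (λ g → L.cap - g - + 3) S.gain-shortest)))
        (≤⇒0≤ L.out≥) (≤⇒0≤ L.in≥) (≤⇒0≤ S.out≤) (≤⇒0≤ S.in≤)

  open Tight public

  2b≤n : b ℕ.+ b ≤ n
  2b≤n = pair-2b≤n sh₀ lo₀

  a+b<n : a ℕ.+ b < n
  a+b<n = pair-a+b<n sh₀ lo₀

-- Exchanging all longest edges with all shortest non-edges

module Exchange {n} (3≤n : 3 ≤ n) (G : Digraph n) (opt : Optimal n G) {a b : ℕ} (ext : Extremal G a b)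
  {x₀ y₀ u₀ v₀ : Fin n} (sh₀ : Shortest G a x₀ y₀) (lo₀ : Longest G b u₀ v₀) where

  open Degrees 3≤n G opt ext sh₀ lo₀

  -- The last out-neighbour of `y` is at distance `b`. It is the closing vertex or lies between it
  -- and `x`, so convexity gives it an edge to `x`.
  leave : ∀ {x y} (sh : Shortest G a x y) → outdeg y ≡ b →
    ∃ λ v → Longest G b y v × CW x y v × edge G v x ≡ true
  leave {x} {y} sh out with OfShortest.closing sh
  ... | w , yw , wx with last-out yw
  ... | v , yv , deg = v , lo , rotate (rotate yvx) , vx
    where
    open OfShortest sh
    lo : Longest G b y v
    lo = longest yv (trans (sym deg) out)
    yvx : CW y v x
    yvx = rotate (out-beyond x≢y ¬yx yv)
    vx : edge G v x ≡ true
    vx with w ≟ v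
    ... | yes refl = wx
    ... | no w≢v with total (edge⇒≢ G yw) w≢v (edge⇒≢ G yv)
    ...   | inj₁ ywv = convexʳ (order₄ yvx ywv) wx
    ...   | inj₂ vwy = ⊥-elim (ℕ.<⇒≱ (d-mono-< (rotate (rotate vwy)))
              (ℕ.≤-trans (edge≤b yw) (ℕ.≤-reflexive (sym (len lo)))))

  arrive : ∀ {x y} (sh : Shortest G a x y) → indeg x ≡ b →
    ∃ λ z → Longest G b z x × CW z x y × edge G y z ≡ true
  arrive {x} {y} sh in′ with OfShortest.closing sh
  ... | w , yw , wx with first-in {x} {w} wx
  ... | z , zx , deg = z , lo , rotate (rotate xyz) , yz
    where
    open OfShortest sh
    lo : Longest G b z x
    lo = longest zx (trans (sym deg) in′)
    xyz : CW x y z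
    xyz = in-beyond x≢y ¬yx zx
    yz : edge G y z ≡ true
    yz with z ≟ w
    ... | yes refl = yw
    ... | no z≢w with total z≢w (edge⇒≢ G wx) (edge⇒≢ G zx)
    ...   | inj₁ zwx = convexˡ (rotate (rotate (chain zwx (rotate (rotate xyz))))) yw
    ...   | inj₂ xwz = ⊥-elim (ℕ.<⇒≱ (d-mono-<ʳ (rotate xwz))
              (ℕ.≤-trans (edge≤b wx) (ℕ.≤-reflexive (sym (len lo)))))

  record After {x y} (sh : Shortest G a x y) : Set where
    field
      {v}    : Fin n
      lo     : Longest G b y v
      turns  : CW x y v
      closes : edge G v x ≡ true
      tight  : Tight sh lo

  record Before {x y} (sh : Shortest G a x y) : Set where
    field
      {z}    : Fin n
      lo     : Longest G b z x
      turns  : CW z x y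
      closes : edge G y z ≡ true
      tight  : Tight sh lo

  after-maximal : ∀ {x y} (sh : Shortest G a x y) → outdeg y ≡ b → After sh
  after-maximal sh out with leave sh out
  ... | v , lo , turns , closes = record
    { lo = lo ; turns = turns ; closes = closes
    ; tight = exchange-loses⇒tight sh lo
        (exchange-after (isNonEdge sh) (len sh) (isEdge lo) (len lo) 2b≤n refl turns closes) }

  before-maximal : ∀ {x y} (sh : Shortest G a x y) → indeg x ≡ b → Before sh
  before-maximal sh in′ with arrive sh in′
  ... | z , lo , turns , closes = record
    { lo = lo ; turns = turns ; closes = closes
    ; tight = exchange-loses⇒tight sh lo
        (exchange-before (isNonEdge sh) (len sh) (isEdge lo) (len lo) 2b≤n refl turns closes) }

  -- One maximal degree permits an adjacent exchange on its side; tightness of that exchange makes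
  -- the other degree maximal and opens the other side.
  context : ∀ {x y} (sh : Shortest G a x y) → After sh × Before sh
  context sh with end-maximal sh lo₀
  ... | inj₁ out = let after = after-maximal sh out in
        after , before-maximal sh (in-max (After.tight after))
  ... | inj₂ in′ = let before = before-maximal sh in′ in
        after-maximal sh (out-max (Before.tight before)) , before

  after : ∀ {x y} (sh : Shortest G a x y) → After sh
  after sh = proj₁ (context sh)

  before : ∀ {x y} (sh : Shortest G a x y) → Before sh
  before sh = proj₂ (context sh)

  -- An edge `mv` would have length `n - a`, which exceeds `b`; this takes the strict inequality
  -- `a + b < n`.
  at-distance-a : ∀ {v m} → v ≢ m → edge G v m ≡ false → d v m ≡ a → Shortest G a v m
  at-distance-a {v} {m} v≢m ¬vm dvm with cases G v≢m
  ... | inj₁ vm = ⊥-elim (true≢false vm ¬vm)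
  ... | inj₂ (inj₂ nvm) = shortest nvm dvm
  ... | inj₂ (inj₁ mv) = ⊥-elim (ℕ.<⇒≱ a+b<n (subst₂ _≤_ (d-flip v≢m) refl
          (ℕ.+-mono-≤ (ℕ.≤-reflexive dvm) (edge≤b mv))))

  record Successor {u v} (lo : Longest G b u v) : Set where
    field
      {y}    : Fin n
      sh     : Shortest G a v y
      turns  : CW u v y
      closes : edge G y u ≡ true
      in-min : ℕ.suc (indeg u) ≡ a

  -- The first vertex that `v` has no edge to is at distance `a`. The longest edge that `before`
  -- provides for this non-edge ends at `v`, so it is `uv` itself, and its tightness transfers.
  successor-minimal : ∀ {u v} (lo : Longest G b u v) → ℕ.suc (outdeg v) ≡ a → Successor lo
  successor-minimal {u} {v} lo out
    with first-non-out (OfLongest.u≢v lo ∘ sym) (OfLongest.¬vu lo)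
  ... | m , v≢m , ¬vm , deg = found
    where
    sh : Shortest G a v m
    sh = at-distance-a v≢m ¬vm (trans (sym deg) out)
    found : Successor lo
    found with before sh
    ... | record { lo = lo′ ; turns = turns ; closes = closes ; tight = tight }
      with refl ← d-injectiveʳ (OfLongest.u≢v lo′) (OfLongest.u≢v lo) (trans (len lo′) (sym (len lo))) =
      record { sh = sh ; turns = turns ; closes = closes ; in-min = in-min tight }

  predecessor : ∀ {u v} → Longest G b u v → ℕ.suc (indeg u) ≡ a → ∃ λ x → Shortest G a x u
  predecessor {u} {v} lo in′ with last-non-in {u} {v} (OfLongest.u≢v lo) (OfLongest.¬vu lo)
  ... | m , u≢m , ¬mu , deg = m , at-distance-a (u≢m ∘ sym) ¬mu (trans (sym deg) in′)

  successor : ∀ {u v} (lo : Longest G b u v) → Successor lo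
  successor {u} {v} lo with end-minimal sh₀ lo
  ... | inj₁ out = successor-minimal lo out
  ... | inj₂ in′ with predecessor lo in′
  ...   | x , sh with after sh
  ...     | record { v = v′ ; lo = lo′ ; tight = tight }
    with refl ← d-injective (OfLongest.u≢v lo′) (OfLongest.u≢v lo) (trans (len lo′) (sym (len lo))) =
    successor-minimal lo (out-min tight)

  -- As `a < b`, the longest edge passes over `y`, and convexity would make `wy` an edge.
  clash : ∀ {w y v} → Shortest G a w y → Longest G b w v → ⊥
  clash sh lo = true≢false
    (convexˡ (d<⇒CW (distinct (isNonEdge sh)) (OfLongest.u≢v lo) (subst₂ _<_ (sym (len sh)) (sym (len lo)) a<b)) (isEdge lo))
    (¬forth (isNonEdge sh))

  A B : Fin n → Fin n → Bool
  A u v = nonEdgeᵇ G u v ∧ ⌊ d u v ℕ.≟ a ⌋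
  B u v = edge G u v ∧ ⌊ d u v ℕ.≟ b ⌋

  isYes⁻ : ∀ {P : Set} (p? : Dec P) → ⌊ p? ⌋ ≡ true → P
  isYes⁻ (yes p) _ = p

  isYes⁺ : ∀ {P : Set} (p? : Dec P) → P → ⌊ p? ⌋ ≡ true
  isYes⁺ (yes _) _ = refl
  isYes⁺ (no ¬p) p = ⊥-elim (¬p p)

  A⁻ : ∀ u v → A u v ≡ true → Shortest G a u v
  A⁻ u v h with ∧-true⁻ {nonEdgeᵇ G u v} h
  ... | ¬uv , duv = shortest (nonEdge⁻ G u v ¬uv) (isYes⁻ (d u v ℕ.≟ a) duv)

  A⁺ : ∀ {u v} → Shortest G a u v → A u v ≡ true
  A⁺ sh = cong₂ _∧_ (nonEdge⁺ (isNonEdge sh)) (isYes⁺ (_ ℕ.≟ _) (len sh))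

  B⁻ : ∀ u v → B u v ≡ true → Longest G b u v
  B⁻ u v h with ∧-true⁻ {edge G u v} h
  ... | uv , duv = longest uv (isYes⁻ (d u v ℕ.≟ b) duv)

  B⁺ : ∀ {u v} → Longest G b u v → B u v ≡ true
  B⁺ lo = cong₂ _∧_ (isEdge lo) (isYes⁺ (_ ℕ.≟ _) (len lo))

  A-false : ∀ {u v} → ¬ Shortest G a u v → A u v ≡ false
  A-false ¬sh = ¬true⇒false (¬sh ∘ A⁻ _ _)

  B-false : ∀ {u v} → ¬ Longest G b u v → B u v ≡ false
  B-false ¬lo = ¬true⇒false (¬lo ∘ B⁻ _ _)

  exchange-move : Move G a b A B
  exchange-move = record
    { A-shortest = λ {u} {v} h → isNonEdge (A⁻ u v h) , len (A⁻ u v h)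
    ; B-longest  = λ {u} {v} h → isEdge (B⁻ u v h) , len (B⁻ u v h)
    ; A-asym     = λ {u} {v} h k → asymmetric (A⁻ u v h) (A⁻ v u k)
    }
    where
    -- The two lengths would add up to `n`, whereas `a + a < b + b ≤ n`.
    asymmetric : ∀ {u v} → Shortest G a u v → Shortest G a v u → ⊥
    asymmetric sh sh′ = ℕ.<⇒≱ (ℕ.<-≤-trans (ℕ.+-mono-< a<b a<b) 2b≤n)
      (ℕ.≤-reflexive (trans (sym (d-flip (distinct (isNonEdge sh)))) (cong₂ ℕ._+_ (len sh) (len sh′))))

  h : Fin n → Fin n → ℤ
  h = signed A B

  h-zero : ∀ {u v} → ¬ Shortest G a u v → ¬ Longest G b u v → h u v ≡ 0ℤ
  h-zero ¬sh ¬lo = cong₂ (λ p q → ⟦ p ⟧ - ⟦ q ⟧) (A-false ¬sh) (B-false ¬lo)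

  h-shortest : ∀ {u v} → Shortest G a u v → h u v ≡ 1ℤ
  h-shortest sh = cong₂ (λ p q → ⟦ p ⟧ - ⟦ q ⟧) (A⁺ sh)
    (B-false λ lo → true≢false (isEdge lo) (¬forth (isNonEdge sh)))

  h-longest : ∀ {u v} → Longest G b u v → h u v ≡ - 1ℤ
  h-longest lo = cong₂ (λ p q → ⟦ p ⟧ - ⟦ q ⟧)
    (A-false λ sh → true≢false (isEdge lo) (¬forth (isNonEdge sh))) (B⁺ lo)

  -- The common level of all slopes: tight degrees give a shortest non-edge the gain `κ - 2` and a
  -- longest edge at most `κ + 2`, and the interactions 2 and -2 bring both to `κ`.
  κ : ℤ
  κ = + 3 * + n - + 4 * (+ a + + b)

  no-consecutive-longest : ∀ {u v w} → Longest G b u v → ¬ Longest G b v w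
  no-consecutive-longest lo = clash (Successor.sh (successor lo))

  interaction-shortest : ∀ {x y} → Shortest G a x y → interaction h x y ≡ + 2
  interaction-shortest {x} {y} sh with after sh
  ... | record { lo = lo ; turns = turns ; closes = closes } =
    trans (interaction-single h turns closes
      (h-zero (λ sh′ → true≢false closes (¬forth (isNonEdge sh′))) (no-consecutive-longest lo))
      (λ t t≢v → h-zero (λ sh′ → clash sh′ lo) λ lo′ → t≢v
        (d-injective (OfLongest.u≢v lo′) (OfLongest.u≢v lo) (trans (len lo′) (sym (len lo))))))
      (cong (λ z → - + 2 * z) (h-longest lo))

  interaction-longest : ∀ {u v} → Longest G b u v → interaction h u v ≡ - + 2
  interaction-longest {u} {v} lo with successor lo
  ... | record { sh = sh ; turns = turns ; closes = closes } =
    trans (interaction-single h turns closes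
      (h-zero (λ sh′ → true≢false closes (¬forth (isNonEdge sh′))) (λ lo′ → no-consecutive-longest lo′ lo))
      (λ t t≢y → h-zero (λ sh′ → t≢y
        (d-injective (distinct (isNonEdge sh′)) (distinct (isNonEdge sh)) (trans (len sh′) (sym (len sh)))))
        (clash sh)))
      (cong (λ z → - + 2 * z) (h-shortest sh))

  slope-shortest : ∀ {x y} → Shortest G a x y → slope (weight G) h x y ≡ κ
  slope-shortest {x} {y} sh = begin
    slope (weight G) h x y
      ≡⟨ slope-split h x y ⟩
    gain x y + interaction h x y
      ≡⟨ cong₂ _+_ (OfShortest.gain-shortest sh) (interaction-shortest sh) ⟩
    + 3 * (+ n - + a - 1ℤ) - + 2 * (+ outdeg y + + indeg x) - (+ a - 1ℤ) + + 2
      ≡⟨ cong₂ (λ p q → + 3 * (+ n - + a - 1ℤ) - + 2 * (+ p + + q) - (+ a - 1ℤ) + + 2) (out-max tight) (in-max tight) ⟩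
    + 3 * (+ n - + a - 1ℤ) - + 2 * (+ b + + b) - (+ a - 1ℤ) + + 2
      ≡⟨ identity (+ n) (+ a) (+ b) ⟩
    κ ∎
    where
    open ≡-Reasoning
    tight = After.tight (after sh)
    identity : ∀ N α β → + 3 * (N - α - 1ℤ) - + 2 * (β + β) - (α - 1ℤ) + + 2 ≡ + 3 * N - + 4 * (α + β)
    identity = solve-∀

  -- An upper bound is enough, because deleted edges enter `change` with coefficient -1.
  slope-longest : ∀ {u v} → Longest G b u v → 0ℤ ≤ᶻ κ - slope (weight G) h u v
  slope-longest {u} {v} lo = 0≤-≡ (OfLongest.gain≤cap lo) (begin
    OfLongest.cap lo - gain u v
      ≡⟨ identity (+ n) (+ b) (+ outdeg v) (+ indeg u) (gain u v) ⟩
    + 3 * + n - + 4 * ((1ℤ + + outdeg v) + + b) + + 2 * (+ outdeg v - + indeg u) - (gain u v + - + 2)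
      ≡⟨ cong₂ (λ p s → + 3 * + n - + 4 * (+ p + + b) + + 2 * (+ outdeg v - + indeg u) - s) out-v
           (sym (trans (slope-split h u v) (cong (λ z → gain u v + z) (interaction-longest lo)))) ⟩
    + 3 * + n - + 4 * (+ a + + b) + + 2 * (+ outdeg v - + indeg u) - slope (weight G) h u v
      ≡⟨ cong (λ p → κ + + 2 * (+ p - + indeg u) - slope (weight G) h u v) (ℕ.suc-injective (trans out-v (sym in-u))) ⟩
    κ + + 2 * (+ indeg u - + indeg u) - slope (weight G) h u v
      ≡⟨ cancel κ (+ indeg u) (slope (weight G) h u v) ⟩
    κ - slope (weight G) h u v ∎)
    where
    open ≡-Reasoning
    in-u : ℕ.suc (indeg u) ≡ a
    in-u = Successor.in-min (successor lo)
    out-v : ℕ.suc (outdeg v) ≡ a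
    out-v = out-min (Before.tight (before (Successor.sh (successor lo))))
    cancel : ∀ k p s → k + + 2 * (p - p) - s ≡ k - s
    cancel = solve-∀
    identity : ∀ N β p q g → + 3 * (N - β - 1ℤ) - + 2 * (p + q) - (β - 1ℤ) - g ≡
      + 3 * N - + 4 * ((1ℤ + p) + β) + + 2 * (p - q) - (g + - + 2)
    identity = solve-∀

  slope-bound : ∀ u w → 0ℤ ≤ᶻ h u w * slope (weight G) h u w - κ * h u w
  slope-bound u w with true⊎false (A u w) | true⊎false (B u w)
  ... | inj₁ Auw | _ = ℤ.≤-reflexive (trans (identity κ)
    (sym (cong₂ (λ i s → i * s - κ * i) (h-shortest (A⁻ u w Auw)) (slope-shortest (A⁻ u w Auw)))))
    where
    identity : ∀ k → 0ℤ ≡ 1ℤ * k - k * 1ℤ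
    identity = solve-∀
  ... | inj₂ _ | inj₁ Buw = 0≤-≡ (slope-longest (B⁻ u w Buw)) (trans (identity κ (slope (weight G) h u w))
    (sym (cong (λ i → i * slope (weight G) h u w - κ * i) (h-longest (B⁻ u w Buw)))))
    where
    identity : ∀ k s → k - s ≡ - 1ℤ * s - k * - 1ℤ
    identity = solve-∀
  ... | inj₂ ¬A | inj₂ ¬B = ℤ.≤-reflexive (trans (identity κ (slope (weight G) h u w))
    (sym (cong₂ (λ i j → (⟦ i ⟧ - ⟦ j ⟧) * slope (weight G) h u w - κ * (⟦ i ⟧ - ⟦ j ⟧)) ¬A ¬B)))
    where
    identity : ∀ k s → 0ℤ ≡ 0ℤ * s - k * 0ℤ
    identity = solve-∀

  -- Shortest non-edges end exactly where longest edges start, and at most one of each does so.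
  arrivals≡departures : ∀ w → sum (λ u → ⟦ A u w ⟧) ≡ sum (λ v → ⟦ B w v ⟧)
  arrivals≡departures w with any? (λ v → B w v Bool.≟ true)
  ... | yes (v , Bwv) = trans one-A (sym one-B)
    where
    lo = B⁻ w v Bwv
    one-B : sum (λ v → ⟦ B w v ⟧) ≡ 1ℤ
    one-B = trans (sum-single v λ t t≢v → cong ⟦_⟧ (B-false λ lo′ → t≢v
      (d-injective (OfLongest.u≢v lo′) (OfLongest.u≢v lo) (trans (len lo′) (sym (len lo)))))) (cong ⟦_⟧ Bwv)
    one-A : sum (λ u → ⟦ A u w ⟧) ≡ 1ℤ
    one-A with predecessor lo (Successor.in-min (successor lo))
    ... | x , sh = trans (sum-single x λ t t≢x → cong ⟦_⟧ (A-false λ sh′ → t≢x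
      (d-injectiveʳ (distinct (isNonEdge sh′)) (distinct (isNonEdge sh)) (trans (len sh′) (sym (len sh))))))
      (cong ⟦_⟧ (A⁺ sh))
  ... | no ∄B = trans
    (sum-zero {n} λ u → cong ⟦_⟧ (A-false λ sh → ∄B (_ , B⁺ (After.lo (after sh)))))
    (sym (sum-zero {n} λ v → cong ⟦_⟧ (¬true⇒false λ Bwv → ∄B (v , Bwv))))

  sum-h : sum₂ h ≡ 0ℤ
  sum-h = begin
    sum₂ h
      ≡⟨ sum₂-sub {n} (λ u v → ⟦ A u v ⟧) (λ u v → ⟦ B u v ⟧) ⟩
    sum₂ (λ u v → ⟦ A u v ⟧) - sum₂ (λ u v → ⟦ B u v ⟧)
      ≡⟨ cong (λ s → s - sum₂ (λ u v → ⟦ B u v ⟧))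
           (trans (∑-comm {n} {n} (λ u v → ⟦ A u v ⟧)) (sum-cong-≗ {n} arrivals≡departures)) ⟩
    sum₂ (λ u v → ⟦ B u v ⟧) - sum₂ (λ u v → ⟦ B u v ⟧)
      ≡⟨ ℤ.+-inverseʳ (sum₂ (λ u v → ⟦ B u v ⟧)) ⟩
    0ℤ ∎
    where open ≡-Reasoning

  change-nonneg : 0ℤ ≤ᶻ change A B
  change-nonneg = 0≤-≡ (sum-nonneg {n} λ u → sum-nonneg {n} λ w → slope-bound u w) (begin
    sum₂ (λ u w → h u w * slope (weight G) h u w - κ * h u w)
      ≡⟨ sum₂-sub {n} (λ u w → h u w * slope (weight G) h u w) (λ u w → κ * h u w) ⟩
    change A B - sum₂ (λ u w → κ * h u w)
      ≡⟨ cong (λ s → change A B - s) (trans (sum-cong-≗ {n} λ u → sum-scale {n} κ (h u)) (sum-scale {n} κ (λ u → sum (h u)))) ⟩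
    change A B - κ * sum₂ h
      ≡⟨ cong (λ s → change A B - κ * s) sum-h ⟩
    change A B - κ * 0ℤ
      ≡⟨ identity (change A B) κ ⟩
    change A B ∎)
    where
    open ≡-Reasoning
    identity : ∀ c k → c - k * 0ℤ ≡ c
    identity = solve-∀

  impossible : ⊥
  impossible = -1-negative
    (0≤+ change-nonneg (change-< exchange-move (λ _ → 2b≤n)
      (isEdge lo₀) (len lo₀) (isNonEdge sh₀) (len sh₀) (inj₁ (A⁺ sh₀))))
    (identity (change A B))
    where
    identity : ∀ c → c + (- c - 1ℤ) ≡ - 1ℤ
    identity = solve-∀

-- The extremal lengths

∈-pairs : (u v : Fin n) → (u , v) ∈ pairs
∈-pairs u v = ∈-concatMap⁺ (λ u → map (λ v → (u , v)) (allFin _))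
  (Any.map (λ { refl → ∈-map⁺ (u ,_) (∈-allFin v) }) (∈-allFin u))

module _ {X : Set} (p : X → Bool) (ℓ : X → ℕ) where

  -- `step` is abstract, with a pointwise equation, because the pattern-matching lambdas in `α` and
  -- `β` cannot be written again as the same function. Attainment needs a positive maximum, since 0
  -- is also the default value.
  foldr-max : (step : X → ℕ → ℕ) → (∀ x acc → step x acc ≡ (if p x then ℓ x ⊔ acc else acc)) → ∀ xs →
    (∀ {x} → x ∈ xs → p x ≡ true → ℓ x ≤ foldr step 0 xs) ×
    (0 < foldr step 0 xs → ∃ λ x → p x ≡ true × ℓ x ≡ foldr step 0 xs)
  foldr-max step spec [] = (λ ()) , λ ()
  foldr-max step spec (y ∷ ys) with foldr-max step spec ys
  ... | upper , attained rewrite spec y (foldr step 0 ys) with p y in py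
  ...   | false = (λ { (here refl) px → ⊥-elim (true≢false px py) ; (there x∈ys) px → upper x∈ys px }) , attained
  ...   | true = (λ { (here refl) _ → ℕ.m≤m⊔n _ _ ; (there x∈ys) px → ℕ.m≤n⇒m≤o⊔n _ (upper x∈ys px) }) , attained′
    where
    attained′ : 0 < ℓ y ⊔ foldr step 0 ys → ∃ λ x → p x ≡ true × ℓ x ≡ ℓ y ⊔ foldr step 0 ys
    attained′ pos with ℕ.⊔-sel (ℓ y) (foldr step 0 ys)
    ... | inj₁ is-y = y , py , sym is-y
    ... | inj₂ is-rest with attained (subst (0 <_) is-rest pos)
    ...   | x , px , ℓx = x , px , trans ℓx (sym is-rest)

  IsMinimum : List X → Maybe ℕ → Set
  IsMinimum xs nothing  = ∀ {x} → x ∈ xs → p x ≡ false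
  IsMinimum xs (just m) = (∃ λ x → p x ≡ true × ℓ x ≡ m) × (∀ {x} → x ∈ xs → p x ≡ true → m ≤ ℓ x)

  foldr-min : (step : X → Maybe ℕ → Maybe ℕ) →
    (∀ x acc → step x acc ≡ (if p x then minℕ∞ (just (ℓ x)) acc else acc)) → ∀ xs →
    IsMinimum xs (foldr step nothing xs)
  foldr-min step spec [] = λ ()
  foldr-min step spec (y ∷ ys) with foldr step nothing ys | foldr-min step spec ys
  ... | rest | ih rewrite spec y rest with p y in py
  foldr-min step spec (y ∷ ys) | nothing | none-in | false =
    λ { (here refl) → py ; (there x∈ys) → none-in x∈ys }
  foldr-min step spec (y ∷ ys) | just m | attained , lower | false =
    attained , λ { (here refl) px → ⊥-elim (true≢false px py) ; (there x∈ys) px → lower x∈ys px }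
  foldr-min step spec (y ∷ ys) | nothing | none-in | true =
    (y , py , refl) , λ { (here refl) _ → ℕ.≤-refl ; (there x∈ys) px → ⊥-elim (true≢false px (none-in x∈ys)) }
  foldr-min step spec (y ∷ ys) | just m | (x , px , ℓx) , lower | true = attained′ ,
    λ { (here refl) _ → ℕ.m⊓n≤m _ _ ; (there x∈ys) px → ℕ.≤-trans (ℕ.m⊓n≤n _ _) (lower x∈ys px) }
    where
    attained′ : ∃ λ x → p x ≡ true × ℓ x ≡ ℓ y ⊓ m
    attained′ with ℕ.⊓-sel (ℓ y) m
    ... | inj₁ is-y = y , py , sym is-y
    ... | inj₂ is-m = x , px , trans ℓx (sym is-m)

β-spec : (G : Digraph n) →
  (∀ {u v} → edge G u v ≡ true → d u v ≤ β G) × (0 < β G → ∃ λ u → ∃ λ v → Longest G (β G) u v)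
β-spec {n} G with foldr-max (λ (u , v) → edge G u v) (λ (u , v) → d u v) _ (λ _ _ → refl) (pairs {n})
... | upper , attained = (λ {u} {v} uv → upper (∈-pairs u v) uv) , found
  where
  found : 0 < β G → ∃ λ u → ∃ λ v → Longest G (β G) u v
  found pos with attained pos
  ... | (u , v) , uv , duv = u , v , longest uv duv

α-spec : (G : Digraph n) →
  IsMinimum (λ (u , v) → nonEdgeᵇ G u v) (λ (u , v) → d u v) pairs (α G)
α-spec {n} G = foldr-min (λ (u , v) → nonEdgeᵇ G u v) (λ (u , v) → d u v) _ (λ _ _ → refl) (pairs {n})

-- Optimal digraphs have a non-edge

path-edge : ∀ {m} → Fin (3 ℕ.+ m) → Fin (3 ℕ.+ m) → Bool
path-edge zero       (suc zero)       = true
path-edge (suc zero) (suc (suc zero)) = true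
path-edge _          _                = false

path-edge⁻ : ∀ {m} (u v : Fin (3 ℕ.+ m)) → path-edge u v ≡ true →
  (u ≡ zero × v ≡ suc zero) ⊎ (u ≡ suc zero × v ≡ suc (suc zero))
path-edge⁻ zero          (suc zero)          _ = inj₁ (refl , refl)
path-edge⁻ (suc zero)    (suc (suc zero))    _ = inj₂ (refl , refl)
path-edge⁻ zero          zero                ()
path-edge⁻ zero          (suc (suc _))       ()
path-edge⁻ (suc zero)    zero                ()
path-edge⁻ (suc zero)    (suc zero)          ()
path-edge⁻ (suc zero)    (suc (suc (suc _))) ()
path-edge⁻ (suc (suc _)) _                   ()

path : ∀ m → Digraph (3 ℕ.+ m)
path m = record { edge = path-edge ; loopless = no-loop }
  where
  no-loop : ∀ u → path-edge u u ≡ false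
  no-loop zero          = refl
  no-loop (suc zero)    = refl
  no-loop (suc (suc _)) = refl

path-admissible : ∀ m → Admissible (path m)
path-admissible m = twoFree , interval
  where
  twoFree : TwoFree (path m)
  twoFree u v (uv , vu) with path-edge⁻ u v uv | path-edge⁻ v u vu
  ... | inj₁ (refl , refl) | inj₁ (() , _)
  ... | inj₁ (refl , refl) | inj₂ (_ , ())
  ... | inj₂ (refl , refl) | inj₁ (() , _)
  ... | inj₂ (refl , refl) | inj₂ (() , _)

  -- The edges join consecutive positions, so there is nothing between their ends.
  nothing-between : ∀ u v w → cwᵇ u v w ≡ true → path-edge u w ≡ true → ⊥
  nothing-between u v w uvw uw with path-edge⁻ u w uw | cw⁻ u v w uvw
  ... | inj₁ (refl , refl) | inj₁ (0<v , v<1) = ℕ.<⇒≱ v<1 0<v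
  ... | inj₁ (refl , refl) | inj₂ (inj₁ (_ , ()))
  ... | inj₁ (refl , refl) | inj₂ (inj₂ (() , _))
  ... | inj₂ (refl , refl) | inj₁ (1<v , v<2) = ℕ.<⇒≱ v<2 1<v
  ... | inj₂ (refl , refl) | inj₂ (inj₁ (_ , s≤s ()))
  ... | inj₂ (refl , refl) | inj₂ (inj₂ (s≤s () , _))

  interval : CircularInterval (path m)
  interval u v w uvw uw = ⊥-elim (nothing-between u v w (Equivalence.to Bool.T-≡ uvw) uw)

Σv-term : (f : Fin n → ℕ) (u : Fin n) → f u ≤ Σv f
Σv-term f u = go (∈-allFin u)
  where
  go : ∀ {xs} → u ∈ xs → f u ≤ sumᴸ (map f xs)
  go (here refl)  = ℕ.m≤m+n _ _
  go (there u∈xs) = ℕ.≤-trans (go u∈xs) (ℕ.m≤n+m _ _)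

0<P̃₃-path : ∀ m → 0 < P̃₃ (path m)
0<P̃₃-path m = ℕ.≤-trans (Σv-term (term zero (suc zero)) (suc (suc zero)))
  (ℕ.≤-trans (Σv-term (λ w → Σv (term zero w)) (suc zero)) (Σv-term (λ u → Σv λ w → Σv (term u w)) zero))
  where
  e = edge (path m)
  term : (u w v : Fin (3 ℕ.+ m)) → ℕ
  term u w v = 𝟙 ((u ≢ᵇ w) ∧ (w ≢ᵇ v) ∧ (u ≢ᵇ v) ∧ e u w ∧ e w v ∧ not (e u v) ∧ not (e v u))

induced-path-exists : 3 ≤ n → ∃ λ (H : Digraph n) → Admissible H × 0 < P̃₃ H
induced-path-exists (s≤s (s≤s (s≤s {n = m} _))) = path m , path-admissible m , 0<P̃₃-path m

P̃₃-tournament : (G : Digraph n) → (∀ u v → nonEdgeᵇ G u v ≡ false) → P̃₃ G ≡ 0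
P̃₃-tournament G complete = Σv-zero λ u → Σv-zero λ w → Σv-zero λ v →
  vanishes (u ≢ᵇ w) (w ≢ᵇ v) (u ≢ᵇ v) (edge G u w) (edge G w v) (complete u v)
  where
  vanishes : ∀ p q r s t {i} → r ∧ i ≡ false → 𝟙 (p ∧ q ∧ r ∧ s ∧ t ∧ i) ≡ 0
  vanishes false _     _     _     _     _    = refl
  vanishes true  false _     _     _     _    = refl
  vanishes true  true  false _     _     _    = refl
  vanishes true  true  true  false _     _    = refl
  vanishes true  true  true  true  false _    = refl
  vanishes true  true  true  true  true  refl = refl

-- The upper bound on the least non-edge length

α≤1+β : (G : Digraph n) → Admissible G → ∀ {a} → (∀ {u v} → NonEdge G u v → a ≤ d u v) →
  ∀ {x y} → NonEdge G x y → d x y ≡ a → a ≤ suc (β G)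
α≤1+β {n} G adm {a} a≤nonEdge {x} {y} ¬xy dxy = ℕ.≮⇒≥ too-far
  where
  open Gain G adm
  outdeg≤β : outdeg x ≤ β G
  outdeg≤β with any? (λ w → edge G x w Bool.≟ true)
  ... | no ∄out = ℕ.≤-trans (ℕ.≤-reflexive (Σv-zero {n} λ w → cong 𝟙 (¬true⇒false λ xw → ∄out (w , xw)))) z≤n
  ... | yes (_ , xw) with last-out xw
  ...   | w , xw , deg = ℕ.≤-trans (ℕ.≤-reflexive deg) (proj₁ (β-spec G) xw)

  -- `yx` is a non-edge as well, so both arcs between `x` and `y` have length at least `a`.
  a+a≤n : a ℕ.+ a ≤ n
  a+a≤n = subst (a ℕ.+ a ≤_) (d-flip (distinct ¬xy)) (ℕ.+-mono-≤ (ℕ.≤-reflexive (sym dxy))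
    (a≤nonEdge (nonEdge (distinct ¬xy ∘ sym) (¬back ¬xy) (¬forth ¬xy))))

  too-far : suc (β G) < a → ⊥
  too-far 1+β<a with first-non-out (distinct ¬xy) (¬forth ¬xy)
  ... | m , x≢m , ¬xm , deg with cases G x≢m
  ...   | inj₁ xm = true≢false xm ¬xm
  ...   | inj₂ (inj₂ nxm) = ℕ.<⇒≱ 1+β<a (ℕ.≤-trans (a≤nonEdge nxm) (ℕ.≤-trans (ℕ.≤-reflexive (sym deg)) (s≤s outdeg≤β)))
  ...   | inj₂ (inj₁ mx) = ℕ.<⇒≱ (ℕ.+-mono-≤-< near back) (subst (a ℕ.+ a ≤_) (sym (d-flip x≢m)) a+a≤n)
    where
    near : d x m ≤ a
    near = ℕ.≤-trans (ℕ.≤-reflexive (sym deg)) (ℕ.≤-trans (s≤s outdeg≤β) (ℕ.<⇒≤ 1+β<a))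
    back : d m x < a
    back = ℕ.≤-<-trans (proj₁ (β-spec G) mx) (ℕ.<-trans (ℕ.n<1+n _) 1+β<a)

theorem3p14 : (n : ℕ) → 4 ≤ n → (G : Digraph n) → Optimal n G →
    (β G ≤∞ α G) × (α G ≡ just (β G) ⊎ α G ≡ just (suc (β G)))
theorem3p14 n 4≤n G opt = conclude (α G) (α-spec G)
  where
  3≤n : 3 ≤ n
  3≤n = ℕ.≤-trans (ℕ.n≤1+n 3) 4≤n

  conclude : ∀ r → IsMinimum (λ (u , v) → nonEdgeᵇ G u v) (λ (u , v) → d u v) pairs r →
    (β G ≤∞ r) × (r ≡ just (β G) ⊎ r ≡ just (suc (β G)))
  -- Without non-edges there is no induced path at all, whereas a directed path on three consecutive
  -- vertices has one.
  conclude nothing complete with induced-path-exists 3≤n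
  ... | H , H-admissible , 0<P̃₃ = ⊥-elim (ℕ.<⇒≱ 0<P̃₃ (ℕ.≤-trans (proj₁ (proj₂ opt) H H-admissible)
    (ℕ.≤-reflexive (P̃₃-tournament G λ u v → complete (∈-pairs u v)))))
  conclude (just a) (((x , y) , ¬xy , dxy) , a-minimal) = β≤a , Sum.map equal (cong just) split
    where
    nonEdge-xy : NonEdge G x y
    nonEdge-xy = nonEdge⁻ G x y ¬xy

    a≤nonEdge : ∀ {u v} → NonEdge G u v → a ≤ d u v
    a≤nonEdge {u} {v} ¬uv = a-minimal (∈-pairs u v) (nonEdge⁺ ¬uv)

    β≤a : β G ≤ a
    β≤a = ℕ.≮⇒≥ λ a<β → let _ , _ , lo = proj₂ (β-spec G) (ℕ.≤-<-trans z≤n a<β) in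
      Exchange.impossible 3≤n G opt
        (record { a<b = a<β ; a≤nonEdge = a≤nonEdge ; edge≤b = proj₁ (β-spec G) })
        (shortest nonEdge-xy dxy) lo

    split : a ≤ β G ⊎ a ≡ suc (β G)
    split with ℕ.m≤n⇒m<n∨m≡n (α≤1+β G (proj₁ opt) a≤nonEdge nonEdge-xy dxy)
    ... | inj₁ (s≤s a≤β) = inj₁ a≤β
    ... | inj₂ a≡1+β     = inj₂ a≡1+β

    equal : a ≤ β G → just a ≡ just (β G)
    equal a≤β = cong just (ℕ.≤-antisym a≤β β≤a)
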